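{- There is a constant $c > 0$ such that, for all integers $m \geq 1$ and $k \geq 2$, the sub-Ramsey number satisfies $$sr(m,k) \leq c\, m k^2 \log k.$$
   Context: Write $[n] = \{1, \ldots, n\}$. A $k$-term arithmetic progression in $[n]$ is a set $\{a, a+d, \ldots, a+(k-1)d\} \subseteq [n]$ with $d \geq 1$ an integer. In a coloring of $[n]$, an arithmetic progression is rainbow if its elements all have different colors. The sub-Ramsey number $sr(m,k)$ is the minimum positive integer $n$ such that every coloring of $[n]$ (with any number of colors) in which no color is used more than $m$ times has a rainbow $k$-term arithmetic progression; the asserted bound includes that such an $n$ exists. Logarithms are to base $e$. -}

module Defs where

open import Data.Fin.Base using (Fin; toℕ)
import Data.Fin.Properties as Fin
open import Data.Integer.Base as ℤ using (+_; +[1+_])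
import Data.Integer.Properties as ℤ
open import Data.Integer.Tactic.RingSolver using () renaming (solve-∀ to ℤ-solve-∀)
open import Data.List.Base using (length; filter; allFin)
open import Data.Nat.Base as ℕ using (ℕ; zero; suc)
import Data.Nat.Properties as ℕ
open import Data.Nat.Tactic.RingSolver using (solve-∀)
open import Data.Product.Base using (_×_; _,_; ∃; ∃₂; proj₁; proj₂)
open import Data.Rational.Base as ℚ
  using (ℚ; mkℚ; 0ℚ; 1ℚ; ½; _/_; _+_; _*_; _-_; -_; 1/_; ∣_∣; _≤_; _<_; *≤*; *<*)
import Data.Rational.Properties as ℚ
import Data.Rational.Unnormalised.Base as ℚᵘ
import Data.Rational.Unnormalised.Properties as ℚᵘ
open import Data.Rational.Solver using (module +-*-Solver)
open import Data.Sum.Base using (inj₁; inj₂)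
open import Function.Base using (_∘_)
open import Function.Definitions using (Injective)
open import Relation.Binary.PropositionalEquality

Cauchy : (ℕ → ℚ) → Set
Cauchy x = ∀ ε → 0ℚ < ε →
  ∃ λ N → ∀ m n → N ℕ.≤ m → N ℕ.≤ n → ∣ x m - x n ∣ < ε

record ℝ : Set where
  constructor mkℝ
  field
    seq    : ℕ → ℚ
    cauchy : Cauchy seq

open ℝ public

infix 4 _≤ʳ_ _<ʳ_
infixl 7 _*ʳ_

_≤ʳ_ : ℝ → ℝ → Set
x ≤ʳ y = ∀ ε → 0ℚ < ε → ∃ λ N → ∀ n → N ℕ.≤ n → seq x n ≤ seq y n + ε

_<ʳ_ : ℝ → ℝ → Set
x <ʳ y = ∃ λ ε → 0ℚ < ε × ∃ λ N → ∀ n → N ℕ.≤ n → seq x n + ε ≤ seq y n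

fromℚ : ℚ → ℝ
fromℚ q = mkℝ (λ _ → q) λ ε 0<ε → 0 , λ _ _ _ _ →
  subst (λ z → ∣ z ∣ < ε) (sym (ℚ.+-inverseʳ q)) 0<ε

fromℕ : ℕ → ℝ
fromℕ n = fromℚ (+ n / 1)

0ʳ : ℝ
0ʳ = fromℕ 0

eventuallyBounded : ∀ {x} → Cauchy x → ∃ λ B → 0ℚ < B × ∃ λ N → ∀ n → N ℕ.≤ n → ∣ x n ∣ ≤ B
eventuallyBounded {x} cx with cx 1ℚ (*<* (ℤ.+<+ (ℕ.s≤s ℕ.z≤n)))
... | N , h = ∣ x N ∣ + 1ℚ , 0<B , N , bound
  where
  0<B : 0ℚ < ∣ x N ∣ + 1ℚ
  0<B = ℚ.+-mono-≤-< {0ℚ} {∣ x N ∣} {0ℚ} {1ℚ} (ℚ.0≤∣p∣ (x N)) (*<* (ℤ.+<+ (ℕ.s≤s ℕ.z≤n)))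
  bound : ∀ n → N ℕ.≤ n → ∣ x n ∣ ≤ ∣ x N ∣ + 1ℚ
  bound n N≤n = begin
    ∣ x n ∣                    ≡⟨ cong ∣_∣ (solve 2 (λ a b → a := b :+ (a :- b)) refl (x n) (x N)) ⟩
    ∣ x N + (x n - x N) ∣      ≤⟨ ℚ.∣p+q∣≤∣p∣+∣q∣ (x N) (x n - x N) ⟩
    ∣ x N ∣ + ∣ x n - x N ∣    ≤⟨ ℚ.+-monoʳ-≤ ∣ x N ∣ (ℚ.<⇒≤ (h n N N≤n ℕ.≤-refl)) ⟩
    ∣ x N ∣ + 1ℚ               ∎
    where open ℚ.≤-Reasoning
          open +-*-Solver

-- If ∣u∣ ≤ C then ∣uv∣ < ε/2 as soon as ∣v∣ < δ = (ε/2)/C.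
factor-small : ∀ C ε → 0ℚ < C → 0ℚ < ε → ∃ λ δ → 0ℚ < δ ×
  (∀ u v → ∣ u ∣ ≤ C → ∣ v ∣ < δ → ∣ u * v ∣ < ½ * ε)
factor-small C ε 0<C 0<ε = η * C⁻¹ , 0<δ , small
  where
  η C⁻¹ : ℚ
  η = ½ * ε
  C⁻¹ = (1/ C) {{ℚ.>-nonZero 0<C}}
  0<η : 0ℚ < η
  0<η = subst (_< η) (ℚ.*-zeroʳ ½) (ℚ.*-monoʳ-<-pos ½ 0<ε)
  0<C⁻¹ : 0ℚ < C⁻¹
  0<C⁻¹ = ℚ.positive⁻¹ C⁻¹ {{ℚ.1/pos⇒pos C {{ℚ.positive 0<C}}}}
  0<δ : 0ℚ < η * C⁻¹
  0<δ = subst (_< η * C⁻¹) (ℚ.*-zeroʳ η) (ℚ.*-monoʳ-<-pos η {{ℚ.positive 0<η}} 0<C⁻¹)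
  Cδ≡η : C * (η * C⁻¹) ≡ η
  Cδ≡η = begin
    C * (η * C⁻¹)    ≡⟨ solve 3 (λ c e i → c :* (e :* i) := e :* (c :* i)) refl C η C⁻¹ ⟩
    η * (C * C⁻¹)    ≡⟨ cong (η *_) (ℚ.*-inverseʳ C {{ℚ.>-nonZero 0<C}}) ⟩
    η * 1ℚ           ≡⟨ ℚ.*-identityʳ η ⟩
    η                ∎
    where open ≡-Reasoning
          open +-*-Solver
  small : ∀ u v → ∣ u ∣ ≤ C → ∣ v ∣ < η * C⁻¹ → ∣ u * v ∣ < η
  small u v u≤ v< = begin-strict
    ∣ u * v ∣        ≡⟨ ℚ.∣p*q∣≡∣p∣*∣q∣ u v ⟩
    ∣ u ∣ * ∣ v ∣    ≤⟨ ℚ.*-monoʳ-≤-nonNeg ∣ v ∣ {{ℚ.∣-∣-nonNeg v}} u≤ ⟩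
    C * ∣ v ∣        <⟨ ℚ.*-monoʳ-<-pos C {{ℚ.positive 0<C}} v< ⟩
    C * (η * C⁻¹)    ≡⟨ Cδ≡η ⟩
    η                ∎
    where open ℚ.≤-Reasoning

product-close : ∀ a b c d ε → ∣ a * (b - d) ∣ < ½ * ε → ∣ d * (a - c) ∣ < ½ * ε →
  ∣ a * b - c * d ∣ < ε
product-close a b c d ε h₁ h₂ = begin-strict
  ∣ a * b - c * d ∣
    ≡⟨ cong ∣_∣ (solve 4 (λ a b c d → a :* b :- c :* d := a :* (b :- d) :+ d :* (a :- c)) refl a b c d) ⟩
  ∣ a * (b - d) + d * (a - c) ∣
    ≤⟨ ℚ.∣p+q∣≤∣p∣+∣q∣ (a * (b - d)) (d * (a - c)) ⟩
  ∣ a * (b - d) ∣ + ∣ d * (a - c) ∣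
    <⟨ ℚ.+-mono-< {∣ a * (b - d) ∣} {½ * ε} {∣ d * (a - c) ∣} {½ * ε} h₁ h₂ ⟩
  ½ * ε + ½ * ε
    ≡⟨ trans (sym (ℚ.*-distribʳ-+ ε ½ ½)) (ℚ.*-identityˡ ε) ⟩
  ε ∎
  where open ℚ.≤-Reasoning
        open +-*-Solver

*-cauchy : ∀ {x y} → Cauchy x → Cauchy y → Cauchy (λ n → x n * y n)
*-cauchy {x} {y} cx cy ε 0<ε = M₁₂ ℕ.⊔ M₃₄ , close
  where
  bx = eventuallyBounded {x} cx
  by = eventuallyBounded {y} cy
  N₁ = proj₁ (proj₂ (proj₂ bx))
  N₂ = proj₁ (proj₂ (proj₂ by))
  fx = factor-small (proj₁ bx) ε (proj₁ (proj₂ bx)) 0<ε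
  fy = factor-small (proj₁ by) ε (proj₁ (proj₂ by)) 0<ε
  dy = cy (proj₁ fx) (proj₁ (proj₂ fx))
  dx = cx (proj₁ fy) (proj₁ (proj₂ fy))
  N₃ = proj₁ dy
  N₄ = proj₁ dx
  M₁₂ = N₁ ℕ.⊔ N₂
  M₃₄ = N₃ ℕ.⊔ N₄
  close : ∀ m n → M₁₂ ℕ.⊔ M₃₄ ℕ.≤ m → M₁₂ ℕ.⊔ M₃₄ ℕ.≤ n → ∣ x m * y m - x n * y n ∣ < ε
  close m n M≤m M≤n = product-close (x m) (y m) (x n) (y n) ε
    (proj₂ (proj₂ fx) (x m) (y m - y n)
      (proj₂ (proj₂ (proj₂ bx)) m (ℕ.m⊔n≤o⇒m≤o N₁ N₂ (ℕ.m⊔n≤o⇒m≤o M₁₂ M₃₄ M≤m)))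
      (proj₂ dy m n (ℕ.m⊔n≤o⇒m≤o N₃ N₄ (ℕ.m⊔n≤o⇒n≤o M₁₂ M₃₄ M≤m))
                    (ℕ.m⊔n≤o⇒m≤o N₃ N₄ (ℕ.m⊔n≤o⇒n≤o M₁₂ M₃₄ M≤n))))
    (proj₂ (proj₂ fy) (y n) (x m - x n)
      (proj₂ (proj₂ (proj₂ by)) n (ℕ.m⊔n≤o⇒n≤o N₁ N₂ (ℕ.m⊔n≤o⇒m≤o M₁₂ M₃₄ M≤n)))
      (proj₂ dx m n (ℕ.m⊔n≤o⇒n≤o N₃ N₄ (ℕ.m⊔n≤o⇒n≤o M₁₂ M₃₄ M≤m))
                    (ℕ.m⊔n≤o⇒n≤o N₃ N₄ (ℕ.m⊔n≤o⇒n≤o M₁₂ M₃₄ M≤n))))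

_*ʳ_ : ℝ → ℝ → ℝ
x *ʳ y = mkℝ (λ n → seq x n * seq y n) (*-cauchy {seq x} {seq y} (cauchy x) (cauchy y))

∑< : ℕ → (ℕ → ℚ) → ℚ
∑< zero    f = 0ℚ
∑< (suc n) f = ∑< n f + f n

-- log k = ∫₁ᵏ dt/t.  The right-endpoint Riemann sum with mesh 1/N has
-- (k-1)N terms (1/N) · 1/(1 + (j+1)/N) = 1/(N+j+1), 0 ≤ j < (k-1)N.
-- (Only meaningful for k ≥ 1; the value at k = 0 is 0.)

riemannSum : ℕ → ℕ → ℚ
riemannSum k N = ∑< ((k ℕ.∸ 1) ℕ.* N) (λ j → + 1 / suc (N ℕ.+ j))

∑<-mono : ∀ n {f g} → (∀ j → j ℕ.< n → f j ≤ g j) → ∑< n f ≤ ∑< n g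
∑<-mono zero    f≤g = ℚ.≤-refl
∑<-mono (suc n) {f} {g} f≤g =
  ℚ.+-mono-≤ {∑< n f} {∑< n g} {f n} {g n}
    (∑<-mono n (λ j j<n → f≤g j (ℕ.m<n⇒m<1+n j<n))) (f≤g n (ℕ.n<1+n n))

∑<-+ : ∀ m n f → ∑< (m ℕ.+ n) f ≡ ∑< m f + ∑< n (λ i → f (m ℕ.+ i))
∑<-+ m zero    f = trans (cong (λ z → ∑< z f) (ℕ.+-identityʳ m)) (sym (ℚ.+-identityʳ _))
∑<-+ m (suc n) f = begin
  ∑< (m ℕ.+ suc n) f                                            ≡⟨ cong (λ z → ∑< z f) (ℕ.+-suc m n) ⟩
  ∑< (m ℕ.+ n) f + f (m ℕ.+ n)                                  ≡⟨ cong (_+ f (m ℕ.+ n)) (∑<-+ m n f) ⟩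
  ∑< m f + ∑< n (λ i → f (m ℕ.+ i)) + f (m ℕ.+ n)               ≡⟨ ℚ.+-assoc (∑< m f) _ _ ⟩
  ∑< m f + (∑< n (λ i → f (m ℕ.+ i)) + f (m ℕ.+ n))             ∎
  where open ≡-Reasoning

∑<-* : ∀ m n f → ∑< (m ℕ.* n) f ≡ ∑< m (λ j → ∑< n (λ i → f (j ℕ.* n ℕ.+ i)))
∑<-* zero    n f = refl
∑<-* (suc m) n f = begin
  ∑< (n ℕ.+ m ℕ.* n) f                                     ≡⟨ cong (λ z → ∑< z f) (ℕ.+-comm n (m ℕ.* n)) ⟩
  ∑< (m ℕ.* n ℕ.+ n) f                                     ≡⟨ ∑<-+ (m ℕ.* n) n f ⟩
  ∑< (m ℕ.* n) f + ∑< n (λ i → f (m ℕ.* n ℕ.+ i))          ≡⟨ cong (λ z → z + ∑< n (λ i → f (m ℕ.* n ℕ.+ i))) (∑<-* m n f) ⟩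
  _                                                        ∎
  where open ≡-Reasoning

∑<-const : ∀ n q → ∑< n (λ _ → q) ≡ (+ n / 1) * q
∑<-const zero    q = sym (ℚ.*-zeroˡ q)
∑<-const (suc n) q = begin
  ∑< n (λ _ → q) + q           ≡⟨ cong (_+ q) (∑<-const n q) ⟩
  (+ n / 1) * q + q            ≡⟨ cong (λ z → (+ n / 1) * q + z) (sym (ℚ.*-identityˡ q)) ⟩
  (+ n / 1) * q + 1ℚ * q       ≡⟨ sym (ℚ.*-distribʳ-+ q (+ n / 1) 1ℚ) ⟩
  ((+ n / 1) + 1ℚ) * q         ≡⟨ cong (_* q) step ⟩
  (+ suc n / 1) * q            ∎
  where
  open ≡-Reasoning
  step : (+ n / 1) + 1ℚ ≡ + suc n / 1
  step = ℚ.toℚᵘ-injective (ℚᵘ.≃-trans (ℚ.toℚᵘ-homo-+ (+ n / 1) 1ℚ)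
    (ℚᵘ.≃-trans (ℚᵘ.+-congˡ _ (ℚ.toℚᵘ-fromℚᵘ (ℚᵘ.mkℚᵘ (+ n) 0)))
    (ℚᵘ.≃-trans {_} {ℚᵘ.mkℚᵘ (+ suc n) 0} (ℚᵘ.*≡* (lemma (+ n)))
    (ℚᵘ.≃-sym (ℚ.toℚᵘ-fromℚᵘ (ℚᵘ.mkℚᵘ (+ suc n) 0))))))
    where
    lemma : ∀ i → (i ℤ.* + 1 ℤ.+ + 1 ℤ.* + 1) ℤ.* + 1 ≡ (+ 1 ℤ.+ i) ℤ.* + 1
    lemma = ℤ-solve-∀

frac : ℕ → ℚ
frac n = + 1 / suc n

frac-anti : ∀ {m n} → m ℕ.≤ n → frac n ≤ frac m
frac-anti {m} {n} m≤n = ℚ.toℚᵘ-cancel-≤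
  (ℚᵘ.≤-respʳ-≃ (ℚᵘ.≃-sym (ℚ.toℚᵘ-fromℚᵘ (ℚᵘ.mkℚᵘ (+ 1) m)))
  (ℚᵘ.≤-respˡ-≃ (ℚᵘ.≃-sym (ℚ.toℚᵘ-fromℚᵘ (ℚᵘ.mkℚᵘ (+ 1) n)))
  (ℚᵘ.*≤* (ℤ.+≤+ (ℕ.s≤s (ℕ.+-monoˡ-≤ 0 m≤n))))))

frac-nonNeg : ∀ n → 0ℚ ≤ frac n
frac-nonNeg n = ℚ.nonNegative⁻¹ (frac n) {{ℚ.normalize-nonNeg 1 (suc n)}}

-- 1/(c+1) = M · 1/(M(c+1)), with M = M′+1.
frac-split : ∀ M′ c → (+ suc M′ / 1) * frac (c ℕ.+ M′ ℕ.* suc c) ≡ frac c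
frac-split M′ c = ℚ.toℚᵘ-injective
  (ℚᵘ.≃-trans (ℚ.toℚᵘ-homo-* (+ suc M′ / 1) (frac (c ℕ.+ M′ ℕ.* suc c)))
  (ℚᵘ.≃-trans (ℚᵘ.*-cong (ℚ.toℚᵘ-fromℚᵘ (ℚᵘ.mkℚᵘ (+ suc M′) 0))
                         (ℚ.toℚᵘ-fromℚᵘ (ℚᵘ.mkℚᵘ (+ 1) (c ℕ.+ M′ ℕ.* suc c))))
  (ℚᵘ.≃-trans {_} {ℚᵘ.mkℚᵘ (+ 1) c} (ℚᵘ.*≡* cross)
  (ℚᵘ.≃-sym (ℚ.toℚᵘ-fromℚᵘ (ℚᵘ.mkℚᵘ (+ 1) c))))))
  where
  open ≡-Reasoning
  cross : + suc M′ ℤ.* + 1 ℤ.* + suc c ≡ + 1 ℤ.* + suc (c ℕ.+ M′ ℕ.* suc c ℕ.+ 0)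
  cross = begin
    + suc M′ ℤ.* + 1 ℤ.* + suc c                    ≡⟨ cong (ℤ._* + suc c) (ℤ.*-identityʳ (+ suc M′)) ⟩
    + suc M′ ℤ.* + suc c                            ≡⟨ sym (ℤ.pos-* (suc M′) (suc c)) ⟩
    + suc (c ℕ.+ M′ ℕ.* suc c)                      ≡⟨ cong (+_ ∘ suc) (sym (ℕ.+-identityʳ _)) ⟩
    + suc (c ℕ.+ M′ ℕ.* suc c ℕ.+ 0)                ≡⟨ sym (ℤ.*-identityˡ _) ⟩
    + 1 ℤ.* + suc (c ℕ.+ M′ ℕ.* suc c ℕ.+ 0)        ∎

-- Passing from mesh 1/N to mesh 1/(NM), with N = N′+1 and M = M′+1.
module _ (k N′ M′ : ℕ) where
  private
    N = suc N′
    M = suc M′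
    K = (k ℕ.∸ 1) ℕ.* N

    refined : riemannSum k (N ℕ.* M) ≡
              ∑< K (λ j → ∑< M (λ i → frac (N ℕ.* M ℕ.+ (j ℕ.* M ℕ.+ i))))
    refined = trans (cong (λ z → ∑< z (λ j → frac (N ℕ.* M ℕ.+ j)))
                          (sym (ℕ.*-assoc (k ℕ.∸ 1) N M)))
                    (∑<-* K M _)

  riemannSum-≤-refine : riemannSum k N ≤ riemannSum k (N ℕ.* M)
  riemannSum-≤-refine = begin
    ∑< K (λ j → frac (N ℕ.+ j))  ≤⟨ ∑<-mono K (λ j _ → block j) ⟩
    _                            ≡⟨ sym refined ⟩
    riemannSum k (N ℕ.* M)       ∎
    where
    open ℚ.≤-Reasoning
    index : ∀ N′ j M′ → suc N′ ℕ.* suc M′ ℕ.+ (j ℕ.* suc M′ ℕ.+ M′) ≡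
                    (suc N′ ℕ.+ j) ℕ.+ M′ ℕ.* suc (suc N′ ℕ.+ j)
    index = solve-∀
    block : ∀ j → frac (N ℕ.+ j) ≤ ∑< M (λ i → frac (N ℕ.* M ℕ.+ (j ℕ.* M ℕ.+ i)))
    block j = begin
      frac (N ℕ.+ j)                                               ≡⟨ sym (frac-split M′ (N ℕ.+ j)) ⟩
      (+ M / 1) * frac ((N ℕ.+ j) ℕ.+ M′ ℕ.* suc (N ℕ.+ j))         ≡⟨ sym (∑<-const M _) ⟩
      ∑< M (λ _ → frac ((N ℕ.+ j) ℕ.+ M′ ℕ.* suc (N ℕ.+ j)))        ≤⟨ ∑<-mono M (λ i i<M →
        frac-anti (subst (N ℕ.* M ℕ.+ (j ℕ.* M ℕ.+ i) ℕ.≤_) (index N′ j M′)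
          (ℕ.+-monoʳ-≤ (N ℕ.* M) (ℕ.+-monoʳ-≤ (j ℕ.* M) (ℕ.s≤s⁻¹ i<M))))) ⟩
      ∑< M (λ i → frac (N ℕ.* M ℕ.+ (j ℕ.* M ℕ.+ i)))              ∎

  riemannSum-refine-≤ : riemannSum k (N ℕ.* M) ≤ riemannSum k N + frac N′
  riemannSum-refine-≤ = begin
    riemannSum k (N ℕ.* M)                       ≡⟨ refined ⟩
    _                                            ≤⟨ ∑<-mono K (λ j _ → block j) ⟩
    ∑< K (λ j → frac (N′ ℕ.+ j))                 ≤⟨ shift K ⟩
    ∑< K (λ j → frac (N ℕ.+ j)) + frac N′        ∎
    where
    open ℚ.≤-Reasoning
    index : ∀ N′ j M′ → (N′ ℕ.+ j) ℕ.+ M′ ℕ.* suc (N′ ℕ.+ j) ℕ.+ 1 ≡ suc N′ ℕ.* suc M′ ℕ.+ (j ℕ.* suc M′)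
    index = solve-∀
    block : ∀ j → ∑< M (λ i → frac (N ℕ.* M ℕ.+ (j ℕ.* M ℕ.+ i))) ≤ frac (N′ ℕ.+ j)
    block j = begin
      ∑< M (λ i → frac (N ℕ.* M ℕ.+ (j ℕ.* M ℕ.+ i)))        ≤⟨ ∑<-mono M (λ i _ → frac-anti
        (ℕ.≤-trans (ℕ.m≤m+n _ 1)
          (subst (ℕ._≤ N ℕ.* M ℕ.+ (j ℕ.* M ℕ.+ i)) (sym (index N′ j M′))
            (ℕ.+-monoʳ-≤ (N ℕ.* M) (ℕ.m≤m+n (j ℕ.* M) i))))) ⟩
      ∑< M (λ _ → frac ((N′ ℕ.+ j) ℕ.+ M′ ℕ.* suc (N′ ℕ.+ j)))  ≡⟨ ∑<-const M _ ⟩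
      (+ M / 1) * frac ((N′ ℕ.+ j) ℕ.+ M′ ℕ.* suc (N′ ℕ.+ j))   ≡⟨ frac-split M′ (N′ ℕ.+ j) ⟩
      frac (N′ ℕ.+ j)                                        ∎
    telescope : ∀ K → ∑< K (λ j → frac (N′ ℕ.+ j)) + frac (N′ ℕ.+ K) ≡
                      ∑< K (λ j → frac (N ℕ.+ j)) + frac N′
    telescope zero    = cong (λ z → 0ℚ + frac z) (ℕ.+-identityʳ N′)
    telescope (suc K) = begin-equality
      a + frac (N′ ℕ.+ K) + frac (N′ ℕ.+ suc K)   ≡⟨ cong₂ _+_ (telescope K) (cong frac (ℕ.+-suc N′ K)) ⟩
      b + frac N′ + frac (N ℕ.+ K)                ≡⟨ solve 3 (λ p q r → p :+ q :+ r := p :+ r :+ q) refl b (frac N′) _ ⟩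
      b + frac (N ℕ.+ K) + frac N′                ∎
      where
      open +-*-Solver
      a = ∑< K (λ j → frac (N′ ℕ.+ j))
      b = ∑< K (λ j → frac (N ℕ.+ j))
    shift : ∀ K → ∑< K (λ j → frac (N′ ℕ.+ j)) ≤ ∑< K (λ j → frac (N ℕ.+ j)) + frac N′
    shift K = begin
      ∑< K (λ j → frac (N′ ℕ.+ j))                           ≡⟨ sym (ℚ.+-identityʳ _) ⟩
      ∑< K (λ j → frac (N′ ℕ.+ j)) + 0ℚ                      ≤⟨ ℚ.+-monoʳ-≤ (∑< K (λ j → frac (N′ ℕ.+ j))) (frac-nonNeg (N′ ℕ.+ K)) ⟩
      ∑< K (λ j → frac (N′ ℕ.+ j)) + frac (N′ ℕ.+ K)         ≡⟨ telescope K ⟩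
      ∑< K (λ j → frac (N ℕ.+ j)) + frac N′                  ∎

-- 1/(d+2) < ε, where d+1 is the denominator of ε.
archimedean : ∀ ε → 0ℚ < ε → ∃ λ d → frac d < ε
archimedean (mkℚ +[1+ a ] d c) _ = suc d , ℚ.toℚᵘ-cancel-<
  (ℚᵘ.<-respˡ-≃ (ℚᵘ.≃-sym (ℚ.toℚᵘ-fromℚᵘ (ℚᵘ.mkℚᵘ (+ 1) (suc d))))
  (ℚᵘ.*<* (ℤ.+<+ (ℕ.≤-trans
    (ℕ.≤-reflexive (cong (suc ∘ suc) (ℕ.+-identityʳ d))) (ℕ.m≤m+n (suc (suc d)) _)))))
archimedean (mkℚ (+ 0) d c) (*<* (ℤ.+<+ ()))
archimedean (mkℚ ℤ.-[1+ a ] d c) (*<* ())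

∣-∣<-intro : ∀ p q ε → p < q + ε → q < p + ε → ∣ p - q ∣ < ε
∣-∣<-intro p q ε p< q< with ℚ.∣p∣≡p∨∣p∣≡-p (p - q)
... | inj₁ eq = subst (_< ε) (sym eq) (subst (p - q <_)
        (solve 2 (λ q e → q :+ e :- q := e) refl q ε) (ℚ.+-monoˡ-< (- q) p<))
  where open +-*-Solver
... | inj₂ eq = subst (_< ε) (sym eq) (subst₂ _<_
        (solve 2 (λ p q → q :- p := :- (p :- q)) refl p q)
        (solve 2 (λ p e → p :+ e :- p := e) refl p ε) (ℚ.+-monoˡ-< (- p) q<))
  where open +-*-Solver

riemannSum-cauchy : ∀ k → Cauchy (riemannSum k)
riemannSum-cauchy k ε 0<ε with archimedean ε 0<ε
... | d , d<ε = suc d , close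
  where
  half : ∀ m n → suc d ℕ.≤ suc n → riemannSum k (suc m) < riemannSum k (suc n) + ε
  half m n d≤n = begin-strict
    riemannSum k (suc m)                 ≤⟨ riemannSum-≤-refine k m n ⟩
    riemannSum k (suc m ℕ.* suc n)       ≡⟨ cong (riemannSum k) (ℕ.*-comm (suc m) (suc n)) ⟩
    riemannSum k (suc n ℕ.* suc m)       ≤⟨ riemannSum-refine-≤ k n m ⟩
    riemannSum k (suc n) + frac n        ≤⟨ ℚ.+-monoʳ-≤ (riemannSum k (suc n)) (frac-anti (ℕ.s≤s⁻¹ d≤n)) ⟩
    riemannSum k (suc n) + frac d        <⟨ ℚ.+-monoʳ-< (riemannSum k (suc n)) d<ε ⟩
    riemannSum k (suc n) + ε             ∎
    where open ℚ.≤-Reasoning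
  close : ∀ m n → suc d ℕ.≤ m → suc d ℕ.≤ n → ∣ riemannSum k m - riemannSum k n ∣ < ε
  close (suc m) (suc n) d≤m d≤n =
    ∣-∣<-intro (riemannSum k (suc m)) (riemannSum k (suc n)) ε (half m n d≤n) (half n m d≤m)

log : ℕ → ℝ
log k = mkℝ (riemannSum k) (riemannSum-cauchy k)

-- [n] = {1, …, n} is represented by Fin n, where i : Fin n stands for
-- the integer toℕ i + 1.

IsArithmeticProgression : ∀ {k n} → (Fin k → Fin n) → Set
IsArithmeticProgression {k} P = ∃₂ λ a d → 1 ℕ.≤ d ×
  ((i : Fin k) → suc (toℕ (P i)) ≡ a ℕ.+ toℕ i ℕ.* d)

AtMost : ∀ {n r} → ℕ → (Fin n → Fin r) → Set
AtMost {n} m f = ∀ c → length (filter (λ x → f x Fin.≟ c) (allFin n)) ℕ.≤ m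

HasRainbowAP : ∀ {n r} → ℕ → (Fin n → Fin r) → Set
HasRainbowAP {n} k f = ∃ λ (P : Fin k → Fin n) →
  IsArithmeticProgression P × Injective _≡_ _≡_ (f ∘ P)

ForcesRainbowAP : ℕ → ℕ → ℕ → Set
ForcesRainbowAP m k n = ∀ r (f : Fin n → Fin r) → AtMost m f → HasRainbowAP k f

-- s = sr(m,k), stated as a relation since existence of sr(m,k) is part of
-- what is to be proved.
record IsSubRamseyNumber (m k s : ℕ) : Set where
  field
    positive : 1 ℕ.≤ s
    forces   : ForcesRainbowAP m k s
    minimal  : ∀ n → 1 ℕ.≤ n → ForcesRainbowAP m k n → s ℕ.≤ n

{-# OPTIONS --safe #-}
-- A k-term progression of difference d that is not rainbow contains x < y of equal colour with y - x = t d, t < k.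
-- Using only differences d with no prime factor below k makes the factorisation y - x = t d unique, so such a pair
-- spoils at most k progressions, whereas n/2 progressions are available for each such d ≤ n/(2k). Hence n = 2kX works
-- as soon as there are more than 2km of these rough numbers below X.
--
-- The number of K-rough d < X is at least a constant times X/log K once X ≥ C K log K: the sum of log d over
-- rough d < X is at least the sum of log p over the pairs (p, e) with e rough, p ≥ K prime and p e < X, which by
-- Chebyshev is at least a constant times the sum of X/e over rough e < X/(C K log K). To bound the sum of 1/e over
-- rough e < Z from below, note that the logarithm of the K-smooth part of n, averaged over n < Z with weights 1/n, is
-- O(∑ log p/p) = O(log K), the sum being over the primes p < K. So at least half of the total weight log Z lies on
-- products s e with e rough and s ≤ K^O(1), and the sum of 1/e is at least a constant times log Z/log K.
module Submission where

open import Defs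
open import Data.Empty using (⊥-elim)
open import Data.Fin.Base as Fin using (Fin; toℕ; fromℕ<; combine; remQuot; splitAt; join; inject≤; finToFun; funToFin)
import Data.Fin.Properties as Fin
import Data.Integer.Base as ℤ
import Data.Integer.Properties as ℤ
open import Data.List.Base using (List; []; _∷_; length; filter; allFin; lookup)
open import Data.List.Membership.Propositional using (_∈_)
open import Data.List.Membership.Propositional.Properties using (∈-filter⁺; ∈-allFin)
open import Data.List.Relation.Binary.Sublist.Propositional using (⊆-refl)
open import Data.List.Relation.Binary.Sublist.Propositional.Properties using (filter⁺; length-mono-≤)
open import Data.List.Relation.Unary.All using (_∷_)
open import Data.List.Relation.Unary.Any using (index)
open import Data.List.Relation.Unary.Any.Properties using (lookup-index)
open import Data.Nat.Base hiding (_/_)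
open import Data.Nat.Combinatorics using (_C_; nC1≡n; k>n⇒nCk≡0; nCk+nC[k+1]≡[n+1]C[k+1])
import Data.Nat.Coprimality as Coprimality
open import Data.Nat.Coprimality using (Coprime; coprime-divisor; prime⇒coprime)
open import Data.Nat.Divisibility
open import Data.Nat.Logarithm using (⌊log₂_⌋; ⌊log₂⌋-mono-≤; ⌊log₂⌊n/2⌋⌋≡⌊log₂n⌋∸1; ⌊log₂[2^n]⌋≡n)
open import Data.Nat.Primality
open import Data.Nat.Primality.Factorisation using (factorise)
open import Data.Nat.Properties
open import Data.Nat.Tactic.RingSolver using (solve-∀)
open import Data.Product.Base using (∃; ∃₂; _×_; _,_; proj₁; proj₂)
open import Data.Rational.Base as ℚ using (ℚ; 0ℚ; 1ℚ; ½; _/_)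
import Data.Rational.Properties as ℚ
import Data.Rational.Unnormalised.Base as ℚᵘ
import Data.Rational.Unnormalised.Properties as ℚᵘ
open import Data.Sum.Base using (_⊎_; inj₁; inj₂; [_,_]′)
open import Function.Base using (_∘_; const)
open import Function.Definitions using (Injective)
open import Relation.Binary.Definitions using (tri<; tri≈; tri>)
open import Relation.Binary.PropositionalEquality
open import Relation.Nullary using (Dec; yes; no; ¬_; contradiction)
open import Relation.Nullary.Decidable using (_×-dec_; _→-dec_; ¬?; map′; from-yes; decidable-stable)

open import Algebra.Properties.CommutativeSemigroup *-commutativeSemigroup using (x∙yz≈y∙xz)

-- Finite sums, indicators and binary logarithms

∑ : ℕ → (ℕ → ℕ) → ℕ
∑ zero    f = 0
∑ (suc n) f = ∑ n f + f n

∑-mono : ∀ n {f g} → (∀ i → i < n → f i ≤ g i) → ∑ n f ≤ ∑ n g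
∑-mono zero    f≤g = z≤n
∑-mono (suc n) f≤g = +-mono-≤ (∑-mono n (λ i i<n → f≤g i (m<n⇒m<1+n i<n))) (f≤g n ≤-refl)

∑-cong : ∀ n {f g} → (∀ i → i < n → f i ≡ g i) → ∑ n f ≡ ∑ n g
∑-cong zero    f≡g = refl
∑-cong (suc n) f≡g = cong₂ _+_ (∑-cong n (λ i i<n → f≡g i (m<n⇒m<1+n i<n))) (f≡g n ≤-refl)

∑-zero : ∀ n → ∑ n (λ _ → 0) ≡ 0
∑-zero zero    = refl
∑-zero (suc n) = trans (+-identityʳ _) (∑-zero n)

∑-const : ∀ n c → ∑ n (λ _ → c) ≡ n * c
∑-const zero    c = refl
∑-const (suc n) c = trans (cong (_+ c) (∑-const n c)) (+-comm (n * c) c)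

∑-distrib-+ : ∀ n f g → ∑ n (λ i → f i + g i) ≡ ∑ n f + ∑ n g
∑-distrib-+ zero    f g = refl
∑-distrib-+ (suc n) f g = trans (cong (_+ (f n + g n)) (∑-distrib-+ n f g))
                                (interchange (∑ n f) (∑ n g) (f n) (g n))
  where
  interchange : ∀ a b c d → a + b + (c + d) ≡ a + c + (b + d)
  interchange = solve-∀

∑-*ˡ : ∀ n c f → ∑ n (λ i → c * f i) ≡ c * ∑ n f
∑-*ˡ zero    c f = sym (*-zeroʳ c)
∑-*ˡ (suc n) c f = trans (cong (_+ c * f n) (∑-*ˡ n c f)) (sym (*-distribˡ-+ c (∑ n f) (f n)))

∑-*ʳ : ∀ n c f → ∑ n (λ i → f i * c) ≡ ∑ n f * c
∑-*ʳ zero    c f = refl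
∑-*ʳ (suc n) c f = trans (cong (_+ f n * c) (∑-*ʳ n c f)) (sym (*-distribʳ-+ c (∑ n f) (f n)))

∑-swap : ∀ m n (f : ℕ → ℕ → ℕ) → ∑ m (λ i → ∑ n (f i)) ≡ ∑ n (λ j → ∑ m (λ i → f i j))
∑-swap zero    n f = sym (∑-zero n)
∑-swap (suc m) n f = trans (cong (_+ ∑ n (f m)) (∑-swap m n f))
                           (sym (∑-distrib-+ n (λ j → ∑ m (λ i → f i j)) (f m)))

∑-+ : ∀ m n f → ∑ (m + n) f ≡ ∑ m f + ∑ n (λ i → f (m + i))
∑-+ m zero    f = trans (cong (λ z → ∑ z f) (+-identityʳ m)) (sym (+-identityʳ _))
∑-+ m (suc n) f = trans (cong (λ z → ∑ z f) (+-suc m n))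
  (trans (cong (_+ f (m + n)) (∑-+ m n f)) (+-assoc (∑ m f) _ _))

∑-≤-length : ∀ {m n} f → m ≤ n → ∑ m f ≤ ∑ n f
∑-≤-length {m} {n} f m≤n = subst (λ z → ∑ m f ≤ ∑ z f) (m+[n∸m]≡n m≤n)
  (subst (∑ m f ≤_) (sym (∑-+ m (n ∸ m) f)) (m≤m+n _ _))

term≤∑ : ∀ {i n} f → i < n → f i ≤ ∑ n f
term≤∑ {i} f i<n = ≤-trans (m≤n+m (f i) (∑ i f)) (∑-≤-length f i<n)

𝟙 : ∀ {a} {P : Set a} → Dec P → ℕ
𝟙 (yes _) = 1
𝟙 (no  _) = 0

module _ {a} {P : Set a} where

  𝟙-yes : (P? : Dec P) → P → 𝟙 P? ≡ 1
  𝟙-yes (yes _) p = refl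
  𝟙-yes (no ¬p) p = contradiction p ¬p

  𝟙-no : (P? : Dec P) → ¬ P → 𝟙 P? ≡ 0
  𝟙-no (yes p) ¬p = contradiction p ¬p
  𝟙-no (no _)  ¬p = refl

  𝟙-*-≤ : (P? : Dec P) → ∀ {x y} → (P → x ≤ y) → 𝟙 P? * x ≤ y
  𝟙-*-≤ (yes p) {x} h = ≤-trans (≤-reflexive (*-identityˡ x)) (h p)
  𝟙-*-≤ (no _)      h = z≤n

  𝟙-*-mono : (P? : Dec P) → ∀ {x y} → (P → x ≤ y) → 𝟙 P? * x ≤ 𝟙 P? * y
  𝟙-*-mono (yes p) {x} h = *-monoʳ-≤ 1 (h p)
  𝟙-*-mono (no _)      h = z≤n

  𝟙≤1 : (P? : Dec P) → 𝟙 P? ≤ 1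
  𝟙≤1 (yes _) = ≤-refl
  𝟙≤1 (no _)  = z≤n

  ≤-𝟙-* : (P? : Dec P) → P → ∀ x → x ≤ 𝟙 P? * x
  ≤-𝟙-* P? p x = ≤-reflexive (sym (trans (cong (_* x) (𝟙-yes P? p)) (*-identityˡ x)))

𝟙-mono : ∀ {a b} {P : Set a} {Q : Set b} (P? : Dec P) (Q? : Dec Q) → (P → Q) → 𝟙 P? ≤ 𝟙 Q?
𝟙-mono (yes p) Q? h = ≤-reflexive (sym (𝟙-yes Q? (h p)))
𝟙-mono (no _)  Q? h = z≤n

-- At most one index passes the test. After an exchange of summations this collapses the sum over
-- all n written as a given product `s * e`.
∑-𝟙≡-≤ : ∀ n m (f : ℕ → ℕ) {b} → (m < n → f m ≤ b) → ∑ n (λ i → 𝟙 (m ≟ i) * f i) ≤ b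
∑-𝟙≡-≤ zero    m f h = z≤n
∑-𝟙≡-≤ (suc n) m f {b} h with m ≟ n
... | no  _    = ≤-trans (≤-reflexive (+-identityʳ _)) (∑-𝟙≡-≤ n m f (λ m<n → h (m<n⇒m<1+n m<n)))
... | yes refl = ≤-trans (≤-reflexive (cong₂ _+_ vanish (*-identityˡ (f m)))) (h ≤-refl)
  where
  vanish : ∑ m (λ i → 𝟙 (m ≟ i) * f i) ≡ 0
  vanish = trans (∑-cong m (λ i i<m → cong (_* f i) (𝟙-no (m ≟ i) (λ { refl → n≮n m i<m })))) (∑-zero m)

lg : ℕ → ℕ
lg n = ⌊log₂ n ⌋

2^n≢0 : ∀ n → NonZero (2 ^ n)
2^n≢0 n = m^n≢0 2 n

1≤2^ : ∀ n → 1 ≤ 2 ^ n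
1≤2^ n = m^n>0 2 n

n<2^n : ∀ n → n < 2 ^ n
n<2^n zero    = s≤s z≤n
n<2^n (suc n) = ≤-trans (s≤s (n<2^n n)) (≤-trans (+-monoˡ-≤ (2 ^ n) (1≤2^ n))
  (≤-reflexive (cong (2 ^ n +_) (sym (+-identityʳ (2 ^ n))))))

2^-mono : ∀ {m n} → m ≤ n → 2 ^ m ≤ 2 ^ n
2^-mono = ^-monoʳ-≤ 2

2^-cancel-< : ∀ m n → 2 ^ m < 2 ^ n → m < n
2^-cancel-< m n lt = ≰⇒> (λ n≤m → <⇒≱ lt (2^-mono n≤m))

lg-mono : ∀ {m n} → m ≤ n → lg m ≤ lg n
lg-mono = ⌊log₂⌋-mono-≤

2^≤⇒≤lg : ∀ {a n} → 2 ^ a ≤ n → a ≤ lg n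
2^≤⇒≤lg {a} h = subst (_≤ _) (⌊log₂[2^n]⌋≡n a) (lg-mono h)

<2^suc⇒lg≤ : ∀ a n → n < 2 ^ suc a → lg n ≤ a
<2^suc⇒lg≤ zero    zero          _ = z≤n
<2^suc⇒lg≤ zero    (suc zero)    _ = z≤n
<2^suc⇒lg≤ zero    (suc (suc n)) (s≤s (s≤s ()))
<2^suc⇒lg≤ (suc a) n n<  = begin
  lg n                ≤⟨ m≤n+m∸n (lg n) 1 ⟩
  1 + (lg n ∸ 1)      ≡⟨ cong suc (⌊log₂⌊n/2⌋⌋≡⌊log₂n⌋∸1 n) ⟨
  1 + lg ⌊ n /2⌋      ≤⟨ s≤s (<2^suc⇒lg≤ a ⌊ n /2⌋ half<) ⟩
  suc a               ∎
  where
  open ≤-Reasoning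
  half< : ⌊ n /2⌋ < 2 ^ suc a
  half< = *-cancelˡ-< 2 ⌊ n /2⌋ (2 ^ suc a) (begin-strict
    2 * ⌊ n /2⌋              ≡⟨ cong (⌊ n /2⌋ +_) (+-identityʳ _) ⟩
    ⌊ n /2⌋ + ⌊ n /2⌋        ≤⟨ +-monoʳ-≤ ⌊ n /2⌋ (⌊n/2⌋≤⌈n/2⌉ n) ⟩
    ⌊ n /2⌋ + ⌈ n /2⌉        ≡⟨ ⌊n/2⌋+⌈n/2⌉≡n n ⟩
    n                        <⟨ n< ⟩
    2 ^ suc (suc a)          ∎)

n<2^[1+lg] : ∀ n → n < 2 ^ suc (lg n)
n<2^[1+lg] n = ≰⇒> (λ h → n≮n (lg n) (2^≤⇒≤lg h))

2^lg≤ : ∀ {n} → 1 ≤ n → 2 ^ lg n ≤ n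
2^lg≤ {n} 1≤n with lg n in eq
... | zero  = 1≤n
... | suc l = ≮⇒≥ (λ n< → n≮n l (subst (_≤ l) eq (<2^suc⇒lg≤ l n n<)))

<2^⇒lg< : ∀ {a n} → 1 ≤ n → n < 2 ^ a → lg n < a
<2^⇒lg< {a} {n} 1≤n n< = 2^-cancel-< (lg n) a (≤-<-trans (2^lg≤ 1≤n) n<)

-- Rounding down makes `lg` superadditive. Upper bounds for products go through `n<2^[1+lg]`
-- instead, whence the `suc (lg p)` in `smoothWeight`.
lg-* : ∀ {m n} → 1 ≤ m → 1 ≤ n → lg m + lg n ≤ lg (m * n)
lg-* {m} {n} 1≤m 1≤n = 2^≤⇒≤lg (≤-trans (≤-reflexive (^-distribˡ-+-* 2 (lg m) (lg n)))
  (*-mono-≤ (2^lg≤ 1≤m) (2^lg≤ 1≤n)))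

-- Primes, rough numbers and smooth parts

π : ℕ → ℕ
π p = 𝟙 (prime? p)

prime>1 : ∀ {p} → Prime p → 1 < p
prime>1 {p} pp = nonTrivial⇒n>1 p {{prime⇒nonTrivial pp}}

1≤lg-prime : ∀ {p} → Prime p → 1 ≤ lg p
1≤lg-prime pp = 2^≤⇒≤lg (prime>1 pp)

-- The witness r collects the distinct primes below N that divide j. Keeping its prime divisors
-- below N in the induction shows that a new prime N does not divide r, hence divides the cofactor
-- of r, so that N r still divides j.
squarefreePart : ∀ N {j} → 1 ≤ j → ∃ λ r → r ∣ j × 1 ≤ r × (∀ q → Prime q → q ∣ r → q < N) ×
  ∑ N (λ p → π p * (𝟙 (p ∣? j) * lg p)) ≤ lg r
squarefreePart zero 1≤j = 1 , 1∣ _ , ≤-refl ,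
  (λ q pq q∣1 → contradiction (∣1⇒≡1 q∣1) (λ { refl → n≮n 1 (prime>1 pq) })) , z≤n
squarefreePart (suc N) {j} 1≤j with squarefreePart N 1≤j
... | r , r∣j , 1≤r , small , bound with prime? N | N ∣? j
... | no _  | _      = r , r∣j , 1≤r , (λ q pq q∣r → m<n⇒m<1+n (small q pq q∣r)) ,
  ≤-trans (≤-reflexive (+-identityʳ _)) bound
... | yes _ | no _   = r , r∣j , 1≤r , (λ q pq q∣r → m<n⇒m<1+n (small q pq q∣r)) ,
  ≤-trans (≤-reflexive (+-identityʳ _)) bound
... | yes pN | yes N∣j@(divides _ _) with r∣j
... | divides c j≡cr with euclidsLemma c r pN (subst (N ∣_) j≡cr N∣j)
...   | inj₂ N∣r = contradiction (small N pN N∣r) (n≮n N)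
...   | inj₁ N∣c = N * r , subst (N * r ∣_) (sym j≡cr) (*-monoˡ-∣ r N∣c) ,
  *-mono-≤ (<⇒≤ (prime>1 pN)) 1≤r , small′ , (begin
    ∑ N (λ p → π p * (𝟙 (p ∣? j) * lg p)) + (lg N + 0 + 0)
      ≤⟨ +-mono-≤ bound (≤-reflexive (trans (+-identityʳ _) (+-identityʳ _))) ⟩
    lg r + lg N    ≡⟨ +-comm (lg r) (lg N) ⟩
    lg N + lg r    ≤⟨ lg-* (<⇒≤ (prime>1 pN)) 1≤r ⟩
    lg (N * r)     ∎)
  where
  open ≤-Reasoning
  small′ : ∀ q → Prime q → q ∣ N * r → q < suc N
  small′ q pq q∣Nr with euclidsLemma N r pq q∣Nr
  ... | inj₁ q∣N = s≤s (∣⇒≤ {{prime⇒nonZero pN}} q∣N)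
  ... | inj₂ q∣r = m<n⇒m<1+n (small q pq q∣r)

∑-lg-prime-divisors : ∀ N {j} → 1 ≤ j → ∑ N (λ p → π p * (𝟙 (p ∣? j) * lg p)) ≤ lg j
∑-lg-prime-divisors N 1≤j with squarefreePart N 1≤j
... | r , r∣j , _ , _ , bound = ≤-trans bound (lg-mono (∣⇒≤ {{>-nonZero 1≤j}} r∣j))

-- Every p divides 0, so the index 0 is masked when multiples are counted.
positive : ℕ → ℕ
positive j = 𝟙 (1 ≤? j)

multiples-≥ : ∀ {p} → 1 ≤ p → ∀ c {N} → p * c < N → c ≤ ∑ N (λ j → positive j * 𝟙 (p ∣? j))
multiples-≥ 1≤p zero    _   = z≤n
multiples-≥ {p} 1≤p (suc c) {N} lt = begin
  suc c                                   ≡⟨ +-comm 1 c ⟩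
  c + 1                                   ≤⟨ +-mono-≤ (multiples-≥ 1≤p c pc<) (≤-reflexive (sym last≡1)) ⟩
  ∑ (p * suc c) f + f (p * suc c)         ≤⟨ ∑-≤-length f lt ⟩
  ∑ N f                                   ∎
  where
  open ≤-Reasoning
  f : ℕ → ℕ
  f j = positive j * 𝟙 (p ∣? j)
  pc< : p * c < p * suc c
  pc< = *-monoʳ-< p {{>-nonZero 1≤p}} (n<1+n c)
  last≡1 : f (p * suc c) ≡ 1
  last≡1 = cong₂ _*_ (𝟙-yes (1 ≤? p * suc c) (*-mono-≤ 1≤p (s≤s z≤n))) (𝟙-yes (p ∣? p * suc c) (m∣m*n (suc c)))

-- Counting pairs (p, j) with p ∣ j < 2^(l+1), each weighted by lg p.
∑-lg/prime : ∀ l → ∑ (2 ^ suc l) (λ p → π p * (lg p * 2 ^ (l ∸ lg p))) ≤ 2 ^ suc l * suc l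
∑-lg/prime l = begin
  ∑ K (λ p → π p * (lg p * 2 ^ (l ∸ lg p)))
    -- `2 ^ (l ∸ lg p)` plays the role of 2^l / p; as p < 2^(lg p + 1), at least that many positive
    -- multiples of p lie below K.
    ≤⟨ ∑-mono K (λ p p<K → 𝟙-*-mono (prime? p) (λ pp → *-monoʳ-≤ (lg p)
         (multiples-≥ (<⇒≤ (prime>1 pp)) (2 ^ (l ∸ lg p)) (p2^< pp p<K)))) ⟩
  ∑ K (λ p → π p * (lg p * ∑ K (λ j → positive j * 𝟙 (p ∣? j))))
    ≡⟨ ∑-cong K (λ p _ → trans (cong (π p *_) (sym (∑-*ˡ K (lg p) _))) (sym (∑-*ˡ K (π p) _))) ⟩
  ∑ K (λ p → ∑ K (λ j → π p * (lg p * (positive j * 𝟙 (p ∣? j)))))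
    ≡⟨ ∑-swap K K _ ⟩
  ∑ K (λ j → ∑ K (λ p → π p * (lg p * (positive j * 𝟙 (p ∣? j)))))
    ≡⟨ ∑-cong K (λ j _ → trans (∑-cong K (λ p _ → rearrange (π p) (lg p) (positive j) (𝟙 (p ∣? j)))) (∑-*ˡ K (positive j) _)) ⟩
  ∑ K (λ j → positive j * ∑ K (λ p → π p * (𝟙 (p ∣? j) * lg p)))
    ≤⟨ ∑-mono K (λ j j<K → 𝟙-*-≤ (1 ≤? j) (λ 1≤j →
         ≤-trans (∑-lg-prime-divisors K 1≤j) (<⇒≤ (<2^⇒lg< 1≤j j<K)))) ⟩
  ∑ K (λ _ → suc l)
    ≡⟨ ∑-const K (suc l) ⟩
  K * suc l ∎
  where
  open ≤-Reasoning
  K = 2 ^ suc l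
  rearrange : ∀ a b c d → a * (b * (c * d)) ≡ c * (a * (d * b))
  rearrange = solve-∀
  p2^< : ∀ {p} → Prime p → p < K → p * 2 ^ (l ∸ lg p) < K
  p2^< {p} pp p<K = begin-strict
    p * 2 ^ (l ∸ lg p)                  <⟨ *-monoˡ-< (2 ^ (l ∸ lg p)) {{2^n≢0 (l ∸ lg p)}} (n<2^[1+lg] p) ⟩
    2 ^ suc (lg p) * 2 ^ (l ∸ lg p)     ≡⟨ ^-distribˡ-+-* 2 (suc (lg p)) (l ∸ lg p) ⟨
    2 ^ suc (lg p + (l ∸ lg p))         ≡⟨ cong (λ z → 2 ^ suc z) (m+[n∸m]≡n (s≤s⁻¹ (<2^⇒lg< (<⇒≤ (prime>1 pp)) p<K))) ⟩
    K                                   ∎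

primeDivisor : ∀ {n} → 1 < n → ∃ λ p → Prime p × p ∣ n
primeDivisor {n} 1<n with factorise n {{>-nonZero (<⇒≤ 1<n)}}
... | record { factors = []    ; isFactorisation = eq } = contradiction (sym eq) (<⇒≢ 1<n)
... | record { factors = p ∷ ps ; isFactorisation = eq ; factorsPrime = pp ∷ _ } =
  p , pp , subst (p ∣_) (sym eq) (m∣m*n _)

hasSmallDivisor? : ∀ K n → Dec (n HasNonTrivialDivisorLessThan K)
hasSmallDivisor? K n = map′
  (λ { (d , d<K , 1<d , d∣n) → hasNonTrivialDivisor {{n>1⇒nonTrivial 1<d}} d<K d∣n })
  (λ { (hasNonTrivialDivisor {d} {{nt}} d<K d∣n) → d , d<K , nonTrivial⇒n>1 d {{nt}} , d∣n })
  (anyUpTo? (λ d → 1 <? d ×-dec d ∣? n) K)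

-- Positivity is a separate clause because 0 is K-rough for K ≤ 2, whereas a difference has to be
-- positive.
IsRough : ℕ → ℕ → Set
IsRough K e = 1 ≤ e × K Rough e

isRough? : ∀ K e → Dec (IsRough K e)
isRough? K e = 1 ≤? e ×-dec ¬? (hasSmallDivisor? K e)

ρ : ℕ → ℕ → ℕ
ρ K e = 𝟙 (isRough? K e)

-- For n < 2^A, the number of a with 1 ≤ a ≤ A and p^a ∣ n is the p-adic valuation of n.
valuation : ℕ → ℕ → ℕ → ℕ
valuation p A n = ∑ A (λ a → 𝟙 (p ^ suc a ∣? n))

-- An upper bound for the binary logarithm of the part of n composed of the primes below K.
smoothWeight : ℕ → ℕ → ℕ → ℕ
smoothWeight K A n = ∑ K (λ p → π p * (suc (lg p) * valuation p A n))

-- The exponent 1 supplies the extra unit, and p^(a+1) dividing n gives p^(a+2) dividing n p; the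
-- cut-off A moves along.
valuation-*-self : ∀ p A n → suc (valuation p A n) ≤ valuation p (suc A) (n * p)
valuation-*-self p A n = subst (suc (valuation p A n) ≤_) (sym (∑-+ 1 A (λ a → 𝟙 (p ^ suc a ∣? n * p))))
  (+-mono-≤ (≤-reflexive (sym (𝟙-yes (p ^ 1 ∣? n * p) (subst (_∣ n * p) (sym (*-identityʳ p)) (n∣m*n n)))))
            (∑-mono A (λ a _ → 𝟙-mono (p ^ suc a ∣? n) (p ^ suc (suc a) ∣? n * p)
              (λ h → subst (_∣ n * p) (*-comm (p ^ suc a) p) (*-monoˡ-∣ p h)))))

valuation-*-≤ : ∀ q p A n → valuation q A n ≤ valuation q (suc A) (n * p)
valuation-*-≤ q p A n = ≤-trans
  (∑-mono A (λ a _ → 𝟙-mono (q ^ suc a ∣? n) (q ^ suc a ∣? n * p) (λ h → ∣m⇒∣m*n p h)))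
  (∑-≤-length (λ a → 𝟙 (q ^ suc a ∣? n * p)) (n≤1+n A))

smoothWeight-* : ∀ K {p} A n → Prime p → p < K →
  suc (lg p) + smoothWeight K A n ≤ smoothWeight K (suc A) (n * p)
smoothWeight-* K {p} A n pp p<K = begin
  suc (lg p) + smoothWeight K A n
    -- Written as a sum over q supported at q = p, the gain can be compared term by term.
    ≤⟨ +-monoˡ-≤ _ (≤-trans (≤-𝟙-* (p ≟ p) refl (suc (lg p))) (term≤∑ (λ q → 𝟙 (p ≟ q) * suc (lg q)) p<K)) ⟩
  ∑ K (λ q → 𝟙 (p ≟ q) * suc (lg q)) + smoothWeight K A n
    ≡⟨ ∑-distrib-+ K _ _ ⟨
  ∑ K (λ q → 𝟙 (p ≟ q) * suc (lg q) + π q * (suc (lg q) * valuation q A n))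
    ≤⟨ ∑-mono K (λ q _ → step q) ⟩
  smoothWeight K (suc A) (n * p) ∎
  where
  open ≤-Reasoning
  step : ∀ q → 𝟙 (p ≟ q) * suc (lg q) + π q * (suc (lg q) * valuation q A n) ≤
               π q * (suc (lg q) * valuation q (suc A) (n * p))
  step q with p ≟ q
  ... | no _ = *-monoʳ-≤ (π q) (*-monoʳ-≤ (suc (lg q)) (valuation-*-≤ q p A n))
  ... | yes refl = begin
    suc (lg p) + 0 + π p * (suc (lg p) * valuation p A n)
      ≡⟨ cong₂ _+_ (+-identityʳ _) (trans (cong (_* (suc (lg p) * valuation p A n)) (𝟙-yes (prime? p) pp)) (*-identityˡ _)) ⟩
    suc (lg p) + suc (lg p) * valuation p A n            ≡⟨ *-suc (suc (lg p)) (valuation p A n) ⟨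
    suc (lg p) * suc (valuation p A n)                   ≤⟨ *-monoʳ-≤ (suc (lg p)) (valuation-*-self p A n) ⟩
    suc (lg p) * valuation p (suc A) (n * p)             ≤⟨ ≤-𝟙-* (prime? p) pp _ ⟩
    π p * (suc (lg p) * valuation p (suc A) (n * p))     ∎

-- Primes below K are split off one at a time until a rough cofactor remains. Each removal at least
-- halves n, so A bounds the number of removals.
smooth×rough : ∀ K A {n} → 1 ≤ n → n < 2 ^ A →
  ∃₂ λ s e → n ≡ s * e × IsRough K e × s ≤ 2 ^ smoothWeight K A n
smooth×rough K zero    {n} 1≤n n<  = contradiction n< (≤⇒≯ 1≤n)
smooth×rough K (suc A) {n} 1≤n n<  with hasSmallDivisor? K n
... | no rough = 1 , n , sym (*-identityˡ n) , (1≤n , rough) , 1≤2^ (smoothWeight K (suc A) n)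
... | yes (hasNonTrivialDivisor {d} {{nt}} d<K d∣n) with primeDivisor (nonTrivial⇒n>1 d {{nt}})
... | p , pp , p∣d with ∣-trans p∣d d∣n
... | divides n′ refl with smooth×rough K A 1≤n′ n′<
  where
  1≤n′ : 1 ≤ n′
  1≤n′ = n≢0⇒n>0 (λ { refl → n≮n 0 1≤n })
  n′< : n′ < 2 ^ A
  n′< = *-cancelʳ-< 2 n′ (2 ^ A) (≤-<-trans (*-monoʳ-≤ n′ (prime>1 pp)) (subst (n′ * p <_) (*-comm 2 (2 ^ A)) n<))
...   | s , e , n′≡se , re , s≤ = p * s , e ,
  trans (*-comm n′ p) (trans (cong (p *_) n′≡se) (sym (*-assoc p s e))) , re , (begin
    p * s                                              ≤⟨ *-mono-≤ (<⇒≤ (n<2^[1+lg] p)) s≤ ⟩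
    2 ^ suc (lg p) * 2 ^ smoothWeight K A n′           ≡⟨ ^-distribˡ-+-* 2 (suc (lg p)) _ ⟨
    2 ^ (suc (lg p) + smoothWeight K A n′)             ≤⟨ 2^-mono (smoothWeight-* K A n′ pp p<K) ⟩
    2 ^ smoothWeight K (suc A) (n′ * p)                ∎)
  where
  open ≤-Reasoning
  p<K : p < K
  p<K = ≤-<-trans (∣⇒≤ {{>-nonZero (<⇒≤ (nonTrivial⇒n>1 d {{nt}}))}} p∣d) d<K

-- The harmonic sum over rough numbers

-- An integral substitute for 2^z/n.
W : ℕ → ℕ → ℕ
W z zero      = 0
W z n@(suc _) = 2 ^ (z ∸ lg n)

W-pos : ∀ z {n} → 1 ≤ n → W z n ≡ 2 ^ (z ∸ lg n)
W-pos z (s≤s _) = refl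

-- The rounding in `W` makes the harmonic sum exact: the block 2^a ≤ n < 2^(a+1) has 2^a terms, each
-- 2^(z-a), and contributes 2^z.
∑-W : ∀ z a → a ≤ z → ∑ (2 ^ a) (W z) ≡ a * 2 ^ z
∑-W z zero    _   = refl
∑-W z (suc a) a<z = begin
  ∑ (2 ^ a + (2 ^ a + 0)) (W z)                             ≡⟨ ∑-+ (2 ^ a) (2 ^ a + 0) (W z) ⟩
  ∑ (2 ^ a) (W z) + ∑ (2 ^ a + 0) (λ i → W z (2 ^ a + i))   ≡⟨ cong₂ _+_ (∑-W z a (<⇒≤ a<z)) block ⟩
  a * 2 ^ z + 2 ^ z                                         ≡⟨ +-comm (a * 2 ^ z) (2 ^ z) ⟩
  suc a * 2 ^ z                                             ∎
  where
  open ≡-Reasoning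
  lg≡ : ∀ i → i < 2 ^ a + 0 → lg (2 ^ a + i) ≡ a
  lg≡ i i< = ≤-antisym (<2^suc⇒lg≤ a _ (+-monoʳ-< (2 ^ a) i<)) (2^≤⇒≤lg (m≤m+n (2 ^ a) i))
  block : ∑ (2 ^ a + 0) (λ i → W z (2 ^ a + i)) ≡ 2 ^ z
  block = begin
    ∑ (2 ^ a + 0) (λ i → W z (2 ^ a + i))
      ≡⟨ ∑-cong (2 ^ a + 0) (λ i i< → trans (W-pos z (≤-trans (1≤2^ a) (m≤m+n (2 ^ a) i))) (cong (λ b → 2 ^ (z ∸ b)) (lg≡ i i<))) ⟩
    ∑ (2 ^ a + 0) (λ _ → 2 ^ (z ∸ a))    ≡⟨ ∑-const (2 ^ a + 0) _ ⟩
    (2 ^ a + 0) * 2 ^ (z ∸ a)            ≡⟨ cong (_* 2 ^ (z ∸ a)) (+-identityʳ (2 ^ a)) ⟩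
    2 ^ a * 2 ^ (z ∸ a)                  ≡⟨ ^-distribˡ-+-* 2 a (z ∸ a) ⟨
    2 ^ (a + (z ∸ a))                    ≡⟨ cong (2 ^_) (m+[n∸m]≡n (<⇒≤ a<z)) ⟩
    2 ^ z                                ∎

-- This replaces 1/(m n) = 1/m · 1/n, with 1/m scaled by 2^b; it comes from the superadditivity of
-- `lg`. The bounds on m n and `lg m` keep the truncated subtractions exact.
W-* : ∀ z b {m n} → 1 ≤ m → 1 ≤ n → m * n < 2 ^ z → lg m ≤ b →
      W z (m * n) * 2 ^ b ≤ 2 ^ (b ∸ lg m) * W z n
W-* z b {m} {n} 1≤m 1≤n mn< lgm≤b = begin
  W z (m * n) * 2 ^ b                            ≡⟨ cong (_* 2 ^ b) (W-pos z (*-mono-≤ 1≤m 1≤n)) ⟩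
  2 ^ (z ∸ lg (m * n)) * 2 ^ b                   ≡⟨ ^-distribˡ-+-* 2 (z ∸ lg (m * n)) b ⟨
  2 ^ (z ∸ lg (m * n) + b)                       ≤⟨ 2^-mono exponents ⟩
  2 ^ ((b ∸ lg m) + (z ∸ lg n))                  ≡⟨ ^-distribˡ-+-* 2 (b ∸ lg m) (z ∸ lg n) ⟩
  2 ^ (b ∸ lg m) * 2 ^ (z ∸ lg n)                ≡⟨ cong (2 ^ (b ∸ lg m) *_) (W-pos z 1≤n) ⟨
  2 ^ (b ∸ lg m) * W z n                         ∎
  where
  open ≤-Reasoning
  lgmn≤z : lg (m * n) ≤ z
  lgmn≤z = <⇒≤ (<2^⇒lg< (*-mono-≤ 1≤m 1≤n) mn<)
  lgn≤z : lg n ≤ z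
  lgn≤z = ≤-trans (m+n≤o⇒n≤o (lg m) (lg-* 1≤m 1≤n)) lgmn≤z
  regroup : ∀ p q r s → p + q + (r + s) ≡ (p + r) + (q + s)
  regroup = solve-∀
  exponents : z ∸ lg (m * n) + b ≤ (b ∸ lg m) + (z ∸ lg n)
  exponents = +-cancelʳ-≤ (lg m + lg n) _ _ (begin
    z ∸ lg (m * n) + b + (lg m + lg n)               ≤⟨ +-monoʳ-≤ _ (lg-* 1≤m 1≤n) ⟩
    z ∸ lg (m * n) + b + lg (m * n)                  ≡⟨ +-assoc (z ∸ lg (m * n)) b _ ⟩
    z ∸ lg (m * n) + (b + lg (m * n))                ≡⟨ cong (z ∸ lg (m * n) +_) (+-comm b _) ⟩
    z ∸ lg (m * n) + (lg (m * n) + b)                ≡⟨ +-assoc (z ∸ lg (m * n)) _ b ⟨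
    z ∸ lg (m * n) + lg (m * n) + b                  ≡⟨ cong (_+ b) (m∸n+n≡m lgmn≤z) ⟩
    z + b                                            ≡⟨ +-comm z b ⟩
    b + z                                            ≡⟨ cong₂ _+_ (m∸n+n≡m lgm≤b) (m∸n+n≡m lgn≤z) ⟨
    (b ∸ lg m + lg m) + (z ∸ lg n + lg n)            ≡⟨ regroup (b ∸ lg m) (z ∸ lg n) (lg m) (lg n) ⟨
    (b ∸ lg m) + (z ∸ lg n) + (lg m + lg n)          ∎)

-- Substituting n = q j compares the sum over multiples of q with the full harmonic sum, at a gain
-- of about q.
∑-W-multiples : ∀ z q → 1 ≤ q → ∑ (2 ^ z) (λ n → 𝟙 (q ∣? n) * W z n) * 2 ^ lg q ≤ z * 2 ^ z
∑-W-multiples z q 1≤q = begin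
  ∑ Z (λ n → 𝟙 (q ∣? n) * W z n) * 2 ^ lg q
    ≡⟨ ∑-*ʳ Z (2 ^ lg q) _ ⟨
  ∑ Z (λ n → 𝟙 (q ∣? n) * W z n * 2 ^ lg q)
    ≤⟨ ∑-mono Z step ⟩
  ∑ Z (λ n → ∑ Z (λ j → 𝟙 (q * j ≟ n) * W z j))
    ≡⟨ ∑-swap Z Z _ ⟩
  ∑ Z (λ j → ∑ Z (λ n → 𝟙 (q * j ≟ n) * W z j))
    ≤⟨ ∑-mono Z (λ j _ → ∑-𝟙≡-≤ Z (q * j) (λ _ → W z j) (λ _ → ≤-refl)) ⟩
  ∑ Z (W z)
    ≡⟨ ∑-W z z ≤-refl ⟩
  z * 2 ^ z ∎
  where
  open ≤-Reasoning
  Z = 2 ^ z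
  step : ∀ n → n < Z → 𝟙 (q ∣? n) * W z n * 2 ^ lg q ≤ ∑ Z (λ j → 𝟙 (q * j ≟ n) * W z j)
  step zero      _  = ≤-trans (≤-reflexive (cong (_* 2 ^ lg q) (*-zeroʳ (𝟙 (q ∣? 0))))) z≤n
  step n@(suc _) n< = ≤-trans (≤-reflexive (*-assoc (𝟙 (q ∣? n)) (W z n) (2 ^ lg q))) (𝟙-*-≤ (q ∣? n) (λ { (divides j n≡jq) → begin
    W z n * 2 ^ lg q
      ≡⟨ cong (λ m → W z m * 2 ^ lg q) (trans n≡jq (*-comm j q)) ⟩
    W z (q * j) * 2 ^ lg q
      ≤⟨ W-* z (lg q) 1≤q (1≤j j n≡jq) (subst (_< Z) (trans n≡jq (*-comm j q)) n<) ≤-refl ⟩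
    2 ^ (lg q ∸ lg q) * W z j
      ≡⟨ trans (cong (λ a → 2 ^ a * W z j) (n∸n≡0 (lg q))) (*-identityˡ _) ⟩
    W z j
      ≤⟨ ≤-𝟙-* (q * j ≟ n) (sym (trans n≡jq (*-comm j q))) (W z j) ⟩
    𝟙 (q * j ≟ n) * W z j
      ≤⟨ term≤∑ (λ j → 𝟙 (q * j ≟ n) * W z j) (≤-<-trans (j≤n j n≡jq) n<) ⟩
    ∑ Z (λ j → 𝟙 (q * j ≟ n) * W z j) ∎ }))
    where
    1≤j : ∀ j → n ≡ j * q → 1 ≤ j
    1≤j (suc j) _ = s≤s z≤n
    j≤n : ∀ j → n ≡ j * q → j ≤ n
    j≤n j eq = ≤-trans (m≤m*n j q {{>-nonZero 1≤q}}) (≤-reflexive (sym eq))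

geometric-sum : ∀ H (u : ℕ → ℕ) → (∀ a → u a * 2 ^ a ≤ H) → ∀ A → ∑ A u ≤ 2 * H
geometric-sum H u h A = *-cancelˡ-≤ (2 ^ A) {{2^n≢0 A}} (m+n≤o⇒m≤o (2 ^ A * ∑ A u) (scaled A))
  where
  open ≤-Reasoning
  e₁ : ∀ t s v H → 2 * t * (s + v) + 2 * H ≡ (t * s + 2 * H) + (t * s + 2 * (v * t))
  e₁ = solve-∀
  e₂ : ∀ t H → t * (2 * H) + t * (2 * H) ≡ 2 * t * (2 * H)
  e₂ = solve-∀
  -- The partial sum stays below 2 H by at least 2 H / 2^A; carrying this gap is what lets the
  -- induction close.
  scaled : ∀ A → 2 ^ A * ∑ A u + 2 * H ≤ 2 ^ A * (2 * H)
  scaled zero    = ≤-reflexive (sym (+-identityʳ (2 * H)))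
  scaled (suc A) = begin
    2 ^ suc A * (∑ A u + u A) + 2 * H
      ≡⟨ e₁ (2 ^ A) (∑ A u) (u A) H ⟩
    (2 ^ A * ∑ A u + 2 * H) + (2 ^ A * ∑ A u + 2 * (u A * 2 ^ A))
      ≤⟨ +-mono-≤ (scaled A) (≤-trans (+-monoʳ-≤ (2 ^ A * ∑ A u) (*-monoʳ-≤ 2 (h A))) (scaled A)) ⟩
    2 ^ A * (2 * H) + 2 ^ A * (2 * H)
      ≡⟨ e₂ (2 ^ A) H ⟩
    2 ^ suc A * (2 * H) ∎

lg-prime-power : ∀ {p} → Prime p → ∀ a → lg p + a ≤ lg (p ^ suc a)
lg-prime-power {p} pp zero    = ≤-reflexive (trans (+-identityʳ _) (cong lg (sym (*-identityʳ p))))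
lg-prime-power {p} pp (suc a) = begin
  lg p + suc a               ≡⟨ +-suc (lg p) a ⟩
  1 + (lg p + a)             ≤⟨ +-mono-≤ (1≤lg-prime pp) (lg-prime-power pp a) ⟩
  lg p + lg (p ^ suc a)      ≤⟨ lg-* (<⇒≤ (prime>1 pp)) (m^n>0 p {{prime⇒nonZero pp}} (suc a)) ⟩
  lg (p * p ^ suc a)         ∎
  where open ≤-Reasoning

-- The sum is reordered by the exponent a: the multiples of p^(a+1) carry at most a share 2^-(lg p +
-- a) of the total weight, and the geometric series contributes the factor 2.
∑-W-valuation : ∀ z {p} → Prime p → ∑ (2 ^ z) (λ n → W z n * valuation p z n) * 2 ^ lg p ≤ 2 * (z * 2 ^ z)
∑-W-valuation z {p} pp = begin
  ∑ Z (λ n → W z n * valuation p z n) * 2 ^ lg p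
    ≡⟨ cong (_* 2 ^ lg p) (trans (∑-cong Z (λ n _ → sym (∑-*ˡ z (W z n) _))) (∑-swap Z z _)) ⟩
  ∑ z (λ a → ∑ Z (λ n → W z n * 𝟙 (p ^ suc a ∣? n))) * 2 ^ lg p
    ≡⟨ cong (_* 2 ^ lg p) (∑-cong z (λ a _ → ∑-cong Z (λ n _ → *-comm (W z n) _))) ⟩
  ∑ z (λ a → T a) * 2 ^ lg p
    ≡⟨ ∑-*ʳ z (2 ^ lg p) T ⟨
  ∑ z (λ a → T a * 2 ^ lg p)
    ≤⟨ geometric-sum (z * 2 ^ z) (λ a → T a * 2 ^ lg p) term z ⟩
  2 * (z * 2 ^ z) ∎
  where
  open ≤-Reasoning
  Z = 2 ^ z
  T : ℕ → ℕ
  T a = ∑ Z (λ n → 𝟙 (p ^ suc a ∣? n) * W z n)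
  term : ∀ a → T a * 2 ^ lg p * 2 ^ a ≤ z * 2 ^ z
  term a = begin
    T a * 2 ^ lg p * 2 ^ a         ≡⟨ *-assoc (T a) (2 ^ lg p) (2 ^ a) ⟩
    T a * (2 ^ lg p * 2 ^ a)       ≡⟨ cong (T a *_) (^-distribˡ-+-* 2 (lg p) a) ⟨
    T a * 2 ^ (lg p + a)           ≤⟨ *-monoʳ-≤ (T a) (2^-mono (lg-prime-power pp a)) ⟩
    T a * 2 ^ lg (p ^ suc a)       ≤⟨ ∑-W-multiples z (p ^ suc a) (m^n>0 p {{prime⇒nonZero pp}} (suc a)) ⟩
    z * 2 ^ z                      ∎

-- The average logarithm of the smooth part is, up to constants, a sum of log p / p over p < K,
-- bounded by `∑-lg/prime`. The 8 is made of `suc (lg p)` ≤ 2 `lg p`, the 2 of `∑-W-valuation` and K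
-- = 2 · 2^l.
∑-W-smoothWeight : ∀ l z → ∑ (2 ^ z) (λ n → W z n * smoothWeight (2 ^ suc l) z n) ≤ 8 * suc l * (z * 2 ^ z)
∑-W-smoothWeight l z = *-cancelˡ-≤ (2 ^ l) {{2^n≢0 l}} (begin
  2 ^ l * ∑ Z (λ n → W z n * smoothWeight K z n)
    ≡⟨ cong (2 ^ l *_) (trans (∑-cong Z (λ n _ → sym (∑-*ˡ K (W z n) _))) (∑-swap Z K _)) ⟩
  2 ^ l * ∑ K (λ p → ∑ Z (λ n → W z n * (π p * (suc (lg p) * valuation p z n))))
    ≡⟨ cong (2 ^ l *_) (∑-cong K (λ p _ → pull p)) ⟩
  2 ^ l * ∑ K (λ p → π p * (suc (lg p) * V p))
    ≡⟨ ∑-*ˡ K (2 ^ l) _ ⟨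
  ∑ K (λ p → 2 ^ l * (π p * (suc (lg p) * V p)))
    ≤⟨ ∑-mono K (λ p p<K → ≤-trans (≤-reflexive (x∙yz≈y∙xz (2 ^ l) (π p) _)) (𝟙-*-mono (prime? p) (λ pp → step p pp p<K))) ⟩
  ∑ K (λ p → π p * (4 * H * (lg p * 2 ^ (l ∸ lg p))))
    ≡⟨ ∑-cong K (λ p _ → x∙yz≈y∙xz (π p) (4 * H) _) ⟩
  ∑ K (λ p → 4 * H * (π p * (lg p * 2 ^ (l ∸ lg p))))
    ≡⟨ ∑-*ˡ K (4 * H) _ ⟩
  4 * H * ∑ K (λ p → π p * (lg p * 2 ^ (l ∸ lg p)))
    ≤⟨ *-monoʳ-≤ (4 * H) (∑-lg/prime l) ⟩
  4 * H * (2 * 2 ^ l * suc l)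
    ≡⟨ e₂ H (2 ^ l) (suc l) ⟩
  2 ^ l * (8 * suc l * H) ∎)
  where
  open ≤-Reasoning
  Z = 2 ^ z
  K = 2 ^ suc l
  H = z * 2 ^ z
  V : ℕ → ℕ
  V p = ∑ Z (λ n → W z n * valuation p z n)
  e₂ : ∀ H t s → 4 * H * (2 * t * s) ≡ t * (8 * s * H)
  e₂ = solve-∀
  e₃ : ∀ w a b c → w * (a * (b * c)) ≡ a * (b * (w * c))
  e₃ = solve-∀
  pull : ∀ p → ∑ Z (λ n → W z n * (π p * (suc (lg p) * valuation p z n))) ≡ π p * (suc (lg p) * V p)
  pull p = trans (∑-cong Z (λ n _ → e₃ (W z n) (π p) (suc (lg p)) (valuation p z n)))
    (trans (∑-*ˡ Z (π p) _) (cong (π p *_) (∑-*ˡ Z (suc (lg p)) _)))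
  e₄ : ∀ a b s v → a * b * (s * v) ≡ s * b * (v * a)
  e₄ = solve-∀
  e₅ : ∀ g d H → 2 * g * d * (2 * H) ≡ 4 * H * (g * d)
  e₅ = solve-∀
  step : ∀ p → Prime p → p < K → 2 ^ l * (suc (lg p) * V p) ≤ 4 * H * (lg p * 2 ^ (l ∸ lg p))
  step p pp p<K = begin
    2 ^ l * (suc (lg p) * V p)
      ≡⟨ cong (λ a → 2 ^ a * (suc (lg p) * V p)) (m+[n∸m]≡n (s≤s⁻¹ (<2^⇒lg< (<⇒≤ (prime>1 pp)) p<K))) ⟨
    2 ^ (lg p + (l ∸ lg p)) * (suc (lg p) * V p)
      ≡⟨ cong (_* (suc (lg p) * V p)) (^-distribˡ-+-* 2 (lg p) (l ∸ lg p)) ⟩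
    2 ^ lg p * 2 ^ (l ∸ lg p) * (suc (lg p) * V p)
      ≡⟨ e₄ (2 ^ lg p) (2 ^ (l ∸ lg p)) (suc (lg p)) (V p) ⟩
    suc (lg p) * 2 ^ (l ∸ lg p) * (V p * 2 ^ lg p)
      ≤⟨ *-mono-≤ (*-monoˡ-≤ (2 ^ (l ∸ lg p)) (+-mono-≤ (1≤lg-prime pp) (≤-reflexive (sym (+-identityʳ (lg p)))))) (∑-W-valuation z pp) ⟩
    2 * lg p * 2 ^ (l ∸ lg p) * (2 * H)
      ≡⟨ e₅ (lg p) (2 ^ (l ∸ lg p)) H ⟩
    4 * H * (lg p * 2 ^ (l ∸ lg p)) ∎

-- Every n < 2^z whose smooth part is below 2^σ is a product s e with e rough and s < 2^σ.
∑-W-small-smooth-part : ∀ K z σ →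
  ∑ (2 ^ z) (λ n → W z n * 𝟙 (smoothWeight K z n <? σ)) ≤ σ * ∑ (2 ^ z) (λ e → ρ K e * W z e)
∑-W-small-smooth-part K z σ = *-cancelʳ-≤ _ _ (2 ^ σ) {{2^n≢0 σ}} (begin
  ∑ Z (λ n → W z n * 𝟙 (smoothWeight K z n <? σ)) * 2 ^ σ
    ≡⟨ ∑-*ʳ Z (2 ^ σ) _ ⟨
  ∑ Z (λ n → W z n * 𝟙 (smoothWeight K z n <? σ) * 2 ^ σ)
    ≤⟨ ∑-mono Z (λ n n< → ≤-trans (≤-reflexive (e₁ (W z n) (𝟙 (smoothWeight K z n <? σ)) (2 ^ σ)))
                                  (𝟙-*-≤ (smoothWeight K z n <? σ) (λ small → factor n n< small))) ⟩
  ∑ Z (λ n → ∑ Z (λ e → ∑ S (λ s → 𝟙 (s * e ≟ n) * w e s)))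
    ≡⟨ ∑-swap Z Z _ ⟩
  ∑ Z (λ e → ∑ Z (λ n → ∑ S (λ s → 𝟙 (s * e ≟ n) * w e s)))
    ≡⟨ ∑-cong Z (λ e _ → ∑-swap Z S _) ⟩
  ∑ Z (λ e → ∑ S (λ s → ∑ Z (λ n → 𝟙 (s * e ≟ n) * w e s)))
    ≤⟨ ∑-mono Z (λ e _ → ∑-mono S (λ s _ → ∑-𝟙≡-≤ Z (s * e) (λ _ → w e s) (λ _ → ≤-refl))) ⟩
  ∑ Z (λ e → ∑ S (w e))
    -- Letting s run over everything below 2^σ costs the full harmonic sum σ 2^σ, the source of the
    -- factor σ.
    ≡⟨ ∑-cong Z (λ e _ → trans (∑-*ˡ S (ρ K e * W z e) (W σ)) (cong (ρ K e * W z e *_) (∑-W σ σ ≤-refl))) ⟩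
  ∑ Z (λ e → ρ K e * W z e * (σ * 2 ^ σ))
    ≡⟨ ∑-*ʳ Z (σ * 2 ^ σ) _ ⟩
  ∑ Z (λ e → ρ K e * W z e) * (σ * 2 ^ σ)
    ≡⟨ e₂ (∑ Z (λ e → ρ K e * W z e)) σ (2 ^ σ) ⟩
  σ * ∑ Z (λ e → ρ K e * W z e) * 2 ^ σ ∎)
  where
  open ≤-Reasoning
  Z = 2 ^ z
  S = 2 ^ σ
  w : ℕ → ℕ → ℕ
  w e s = ρ K e * W z e * W σ s
  e₁ : ∀ a b c → a * b * c ≡ b * (a * c)
  e₁ = solve-∀
  e₂ : ∀ a b c → a * (b * c) ≡ b * a * c
  e₂ = solve-∀
  factor : ∀ n → n < Z → smoothWeight K z n < σ →
    W z n * 2 ^ σ ≤ ∑ Z (λ e → ∑ S (λ s → 𝟙 (s * e ≟ n) * w e s))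
  factor zero      _  _     = z≤n
  factor n@(suc _) n< small with smooth×rough K z {n} (s≤s z≤n) n<
  ... | s , e , n≡se , re@(1≤e , _) , s≤ = begin
    W z n * 2 ^ σ                          ≡⟨ cong (λ m → W z m * 2 ^ σ) n≡se ⟩
    W z (s * e) * 2 ^ σ                    ≤⟨ W-* z σ 1≤s 1≤e (subst (_< Z) n≡se n<) (<⇒≤ (<2^⇒lg< 1≤s s<)) ⟩
    2 ^ (σ ∸ lg s) * W z e                 ≡⟨ cong (_* W z e) (W-pos σ 1≤s) ⟨
    W σ s * W z e                          ≡⟨ *-comm (W σ s) (W z e) ⟩
    W z e * W σ s                          ≤⟨ *-monoˡ-≤ (W σ s) (≤-𝟙-* (isRough? K e) re (W z e)) ⟩
    w e s                                  ≤⟨ ≤-𝟙-* (s * e ≟ n) (sym n≡se) (w e s) ⟩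
    𝟙 (s * e ≟ n) * w e s                  ≤⟨ term≤∑ (λ s → 𝟙 (s * e ≟ n) * w e s) s< ⟩
    ∑ S (λ s → 𝟙 (s * e ≟ n) * w e s)      ≤⟨ term≤∑ (λ e → ∑ S (λ s → 𝟙 (s * e ≟ n) * w e s)) e< ⟩
    ∑ Z (λ e → ∑ S (λ s → 𝟙 (s * e ≟ n) * w e s)) ∎
    where
    positive-factor : ∀ s → n ≡ s * e → 1 ≤ s
    positive-factor (suc _) _ = s≤s z≤n
    1≤s : 1 ≤ s
    1≤s = positive-factor s n≡se
    s< : s < S
    s< = ≤-<-trans s≤ (^-monoʳ-< 2 (s≤s (s≤s z≤n)) small)
    e< : e < Z
    e< = ≤-<-trans (≤-trans (m≤n*m e s {{>-nonZero 1≤s}}) (≤-reflexive (sym n≡se))) n<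

-- Markov's inequality: at least half of the weight lies on the n with smooth part below 2^(16 (l + 1)).
∑-W-rough : ∀ l z → z * 2 ^ z ≤ 32 * suc l * ∑ (2 ^ z) (λ e → ρ (2 ^ suc l) e * W z e)
∑-W-rough l z = begin
  H                     ≤⟨ +-cancelʳ-≤ H H (2 * small) (begin
    H + H                 ≡⟨ cong₂ _+_ split split ⟩
    small + large + (small + large)   ≡⟨ e₁ small large ⟩
    2 * small + 2 * large ≤⟨ +-monoʳ-≤ (2 * small) large≤ ⟩
    2 * small + H ∎) ⟩
  2 * small             ≤⟨ *-monoʳ-≤ 2 (∑-W-small-smooth-part K z σ) ⟩
  2 * (16 * suc l * E)  ≡⟨ e₂ (suc l) E ⟩
  32 * suc l * E        ∎
  where
  open ≤-Reasoning
  Z = 2 ^ z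
  K = 2 ^ suc l
  H = z * 2 ^ z
  -- Twice the average from `∑-W-smoothWeight`, so that at most half of the weight falls into
  -- `large`.
  σ = 16 * suc l
  E = ∑ Z (λ e → ρ K e * W z e)
  small = ∑ Z (λ n → W z n * 𝟙 (smoothWeight K z n <? σ))
  large = ∑ Z (λ n → W z n * 𝟙 (σ ≤? smoothWeight K z n))
  e₁ : ∀ a b → a + b + (a + b) ≡ 2 * a + 2 * b
  e₁ = solve-∀
  e₂ : ∀ s E → 2 * (16 * s * E) ≡ 32 * s * E
  e₂ = solve-∀
  e₃ : ∀ s B → 16 * s * B ≡ 8 * s * (2 * B)
  e₃ = solve-∀
  e₄ : ∀ s w i → s * (w * i) ≡ w * (i * s)
  e₄ = solve-∀
  cases : ∀ n → 1 ≡ 𝟙 (smoothWeight K z n <? σ) + 𝟙 (σ ≤? smoothWeight K z n)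
  cases n with smoothWeight K z n <? σ
  ... | yes lt = cong suc (sym (𝟙-no (σ ≤? smoothWeight K z n) (<⇒≱ lt)))
  ... | no ≮   = sym (𝟙-yes (σ ≤? smoothWeight K z n) (≮⇒≥ ≮))
  split : H ≡ small + large
  split = trans (sym (∑-W z z ≤-refl)) (trans
    (∑-cong Z (λ n _ → trans (sym (*-identityʳ (W z n))) (trans (cong (W z n *_) (cases n)) (*-distribˡ-+ (W z n) _ _))))
    (∑-distrib-+ Z _ _))
  large≤ : 2 * large ≤ H
  large≤ = *-cancelˡ-≤ (8 * suc l) (begin
    8 * suc l * (2 * large)   ≡⟨ e₃ (suc l) large ⟨
    σ * large                 ≡⟨ ∑-*ˡ Z σ _ ⟨
    ∑ Z (λ n → σ * (W z n * 𝟙 (σ ≤? smoothWeight K z n)))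
      ≤⟨ ∑-mono Z (λ n _ → ≤-trans (≤-reflexive (e₄ σ (W z n) _))
           (*-monoʳ-≤ (W z n) (𝟙-*-≤ (σ ≤? smoothWeight K z n) (λ h → h)))) ⟩
    ∑ Z (λ n → W z n * smoothWeight K z n)
      ≤⟨ ∑-W-smoothWeight l z ⟩
    8 * suc l * H ∎)

-- Chebyshev's lower bound

prime∣^⇒∣ : ∀ {p} → Prime p → ∀ q a → p ∣ q ^ a → p ∣ q
prime∣^⇒∣ pp q zero    p∣1 = contradiction (∣1⇒≡1 p∣1) (λ { refl → n≮n 1 (prime>1 pp) })
prime∣^⇒∣ pp q (suc a) h with euclidsLemma q (q ^ a) pp h
... | inj₁ p∣q  = p∣q
... | inj₂ p∣q^ = prime∣^⇒∣ pp q a p∣q^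

prime^-coprime : ∀ {p q} → Prime p → Prime q → q ≢ p → ∀ a → Coprime (q ^ a) p
prime^-coprime {p} {q} pp pq q≢p a (d∣q^a , d∣p) with prime⇒irreducible pp d∣p
... | inj₁ d≡1  = d≡1
... | inj₂ refl with prime⇒irreducible pq (prime∣^⇒∣ pp q a d∣q^a)
...   | inj₁ refl = contradiction (prime>1 pp) (n≮n 1)
...   | inj₂ refl = contradiction refl q≢p

-- A prime p dividing j is cancelled from j and M: for q = p the hypothesis is used at the next
-- exponent, for q ≠ p the power q^a is coprime to p. Each cancellation at least halves j, so A
-- serves as fuel.
∣-local : ∀ A {j M} → j < 2 ^ A → 1 ≤ j → (∀ q → Prime q → ∀ a → q ^ a ∣ j → q ^ a ∣ M) → j ∣ M
∣-local zero    j<1 1≤j h = contradiction j<1 (≤⇒≯ 1≤j)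
∣-local (suc A) {j} {M} j< 1≤j h with 1 <? j
... | no j≤1  = subst (_∣ M) (≤-antisym 1≤j (≮⇒≥ j≤1)) (1∣ M)
... | yes 1<j with primeDivisor 1<j
... | p , pp , divides j′ refl with h p pp 1 (subst (_∣ j′ * p) (sym (*-identityʳ p)) (n∣m*n j′))
... | divides M′ M≡ = subst (j′ * p ∣_) (sym M≡M′p) (*-monoˡ-∣ p (∣-local A j′< 1≤j′ h′))
  where
  M≡M′p : M ≡ M′ * p
  M≡M′p = trans M≡ (cong (M′ *_) (*-identityʳ p))
  1≤j′ : 1 ≤ j′
  1≤j′ = n≢0⇒n>0 (λ { refl → n≮n 0 1≤j })
  j′< : j′ < 2 ^ A
  j′< = *-cancelʳ-< 2 j′ (2 ^ A) (≤-<-trans (*-monoʳ-≤ j′ (prime>1 pp)) (subst (j′ * p <_) (*-comm 2 (2 ^ A)) j<))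
  h′ : ∀ q → Prime q → ∀ a → q ^ a ∣ j′ → q ^ a ∣ M′
  h′ q pq a q^a∣j′ with q ≟ p
  ... | yes refl = *-cancelˡ-∣ p {{prime⇒nonZero pp}} (subst (p * p ^ a ∣_) (trans M≡M′p (*-comm M′ p))
          (h p pp (suc a) (subst (p * p ^ a ∣_) (*-comm p j′) (*-monoʳ-∣ p q^a∣j′))))
  ... | no q≢p   = coprime-divisor (prime^-coprime pp pq q≢p a)
          (subst (q ^ a ∣_) (trans M≡M′p (*-comm M′ p)) (h q pq a (∣m⇒∣m*n p q^a∣j′)))

maxPower : ∀ {p N} → 1 < p → ∀ fuel κ → p ^ κ ≤ N → N < p ^ (κ + fuel) →
  ∃ λ κ′ → p ^ κ′ ≤ N × (∀ a → p ^ a ≤ N → a ≤ κ′)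
maxPower {p} {N} 1<p zero       κ lo hi = contradiction (subst (λ e → N < p ^ e) (+-identityʳ κ) hi) (≤⇒≯ lo)
maxPower {p} {N} 1<p (suc fuel) κ lo hi with p ^ suc κ ≤? N
... | yes lo′ = maxPower 1<p fuel (suc κ) lo′ (subst (λ e → N < p ^ e) (+-suc κ fuel) hi)
... | no N<   = κ , lo , λ a p^a≤N → ≮⇒≥ (λ κ<a →
  N< (≤-trans (^-monoʳ-≤ p {{>-nonZero (<⇒≤ 1<p)}} κ<a) p^a≤N))

-- M is the product, over the primes below B, of the largest power of each not exceeding N; each of
-- these `∑ B π` factors is at most N.
primePowerMultiple : ∀ {N} → 1 ≤ N → ∀ B → ∃ λ M → 1 ≤ M × M ≤ N ^ ∑ B π ×
  (∀ q → Prime q → q < B → ∀ a → q ^ a ≤ N → q ^ a ∣ M)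
primePowerMultiple 1≤N zero = 1 , ≤-refl , ≤-refl , λ _ _ ()
primePowerMultiple {N} 1≤N (suc B) with primePowerMultiple 1≤N B
... | M , 1≤M , M≤ , h with prime? B
... | no ¬pB = M , 1≤M , subst (λ e → M ≤ N ^ e) (sym (+-identityʳ (∑ B π))) M≤ , h′
  where
  h′ : ∀ q → Prime q → q < suc B → ∀ a → q ^ a ≤ N → q ^ a ∣ M
  h′ q pq q≤B with m<1+n⇒m<n∨m≡n q≤B
  ... | inj₁ q<B  = h q pq q<B
  ... | inj₂ refl = contradiction pq ¬pB
... | yes pB with maxPower (prime>1 pB) N 0 1≤N
                    (<-≤-trans (n<2^n N) (^-monoˡ-≤ N (prime>1 pB)))
... | κ , B^κ≤N , maximal = B ^ κ * M , *-mono-≤ (m^n>0 B {{prime⇒nonZero pB}} κ) 1≤M ,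
    (begin
      B ^ κ * M            ≤⟨ *-mono-≤ B^κ≤N M≤ ⟩
      N ^ suc (∑ B π)      ≡⟨ cong (N ^_) (+-comm 1 (∑ B π)) ⟩
      N ^ (∑ B π + 1)      ∎) , h′
  where
  open ≤-Reasoning
  h′ : ∀ q → Prime q → q < suc B → ∀ a → q ^ a ≤ N → q ^ a ∣ B ^ κ * M
  h′ q pq q≤B a q^a≤N with m<1+n⇒m<n∨m≡n q≤B
  ... | inj₁ q<B  = ∣n⇒∣m*n (B ^ κ) (h q pq q<B a q^a≤N)
  ... | inj₂ refl = ∣m⇒∣m*n M (m^n∣m^o B (maximal a q^a≤N))
    where
    m^n∣m^o : ∀ m {n o} → n ≤ o → m ^ n ∣ m ^ o
    m^n∣m^o m {n} {o} n≤o = subst (m ^ n ∣_) (trans (sym (^-distribˡ-+-* m n (o ∸ n))) (cong (m ^_) (m+[n∸m]≡n n≤o))) (m∣m*n (m ^ (o ∸ n)))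

-- M takes the place of the least common multiple of 1, ..., N: a prime power dividing some j ≤ N is
-- at most N, and so is its base.
commonMultiple : ∀ {N} → 1 ≤ N → ∃ λ M → 1 ≤ M × M ≤ N ^ ∑ (suc N) π × (∀ j → 1 ≤ j → j ≤ N → j ∣ M)
commonMultiple {N} 1≤N with primePowerMultiple 1≤N (suc N)
... | M , 1≤M , M≤ , h = M , 1≤M , M≤ , λ j 1≤j j≤N → ∣-local j (n<2^n j) 1≤j (λ q pq a q^a∣j →
  local q pq a (≤-trans (∣⇒≤ {{>-nonZero 1≤j}} q^a∣j) j≤N))
  where
  local : ∀ q → Prime q → ∀ a → q ^ a ≤ N → q ^ a ∣ M
  local q pq zero    _     = 1∣ M
  local q pq (suc a) q^a≤N = h q pq
    (s≤s (≤-trans (m≤m*n q (q ^ a) {{m^n≢0 q a {{prime⇒nonZero pq}}}}) q^a≤N)) (suc a) q^a≤N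

C-absorption : ∀ n j → suc j * (suc n C suc j) ≡ suc n * (n C j)
C-absorption n zero = trans (*-identityˡ _) (trans (nC1≡n (suc n)) (sym (*-identityʳ (suc n))))
C-absorption zero (suc j) = trans (cong (suc (suc j) *_) (k>n⇒nCk≡0 {1} {suc (suc j)} (s≤s (s≤s z≤n))))
  (trans (*-zeroʳ (suc (suc j))) (sym (trans (*-identityˡ _) (k>n⇒nCk≡0 {0} {suc j} (s≤s z≤n)))))
C-absorption (suc n) (suc j) = begin
  suc (suc j) * (suc (suc n) C suc (suc j))                                 ≡⟨ cong (suc (suc j) *_) (nCk+nC[k+1]≡[n+1]C[k+1] (suc n) (suc j)) ⟨
  suc (suc j) * (c + (suc n C suc (suc j)))                                 ≡⟨ *-distribˡ-+ (suc (suc j)) c _ ⟩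
  c + suc j * c + suc (suc j) * (suc n C suc (suc j))                       ≡⟨ cong₂ (λ u v → c + u + v) (C-absorption n j) (C-absorption n (suc j)) ⟩
  c + suc n * (n C j) + suc n * (n C suc j)                                 ≡⟨ e c (suc n) (n C j) (n C suc j) ⟩
  c + suc n * ((n C j) + (n C suc j))                                       ≡⟨ cong (λ u → c + suc n * u) (nCk+nC[k+1]≡[n+1]C[k+1] n j) ⟩
  suc (suc n) * c                                                           ∎
  where
  open ≡-Reasoning
  c = suc n C suc j
  e : ∀ c s a b → c + s * a + s * b ≡ c + s * (a + b)
  e = solve-∀

-- Leibniz's harmonic triangle: with a = (n+1) C(n,j), b = n C(n-1,j), c = (n+1) C(n,j+1)
-- one has 1/b = 1/a + 1/c, so a common multiple of a and b is a multiple of c.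
leibniz-∣ : ∀ {N M} → 1 ≤ M → (∀ j → 1 ≤ j → j ≤ N → j ∣ M) →
  ∀ j n → j ≤ n → n < N → suc n * (n C j) ∣ M
leibniz-∣ {N} {M} 1≤M h zero n _ n<N = subst (_∣ M) (sym (*-identityʳ (suc n))) (h (suc n) (s≤s z≤n) n<N)
leibniz-∣ {N} {M} 1≤M h (suc j) n@(suc n′) (s≤s j≤n′) n<N
  with leibniz-∣ 1≤M h j n (m≤n⇒m≤1+n j≤n′) n<N | leibniz-∣ 1≤M h j n′ j≤n′ (<⇒≤ n<N)
-- Multiplying 1/b = 1/a + 1/c by M c gives y c = x c + M, and so c divides M.
... | divides x M≡xa | divides y M≡yb = ∣m+n∣m⇒∣n {m = x * c} (divides y x*c+M≡yc) (n∣m*n x)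
  where
  a = suc n * (n C j)
  b = n * (n′ C j)
  c = suc n * (n C suc j)
  instance a≢0 : NonZero a
  a≢0 = ≢-nonZero (λ a≡0 → n≮n 0 (subst (1 ≤_) (trans M≡xa (trans (cong (x *_) a≡0) (*-zeroʳ x))) 1≤M))
  open ≡-Reasoning
  e₁ : ∀ s j p q → j * q * (s * p + s * q) ≡ s * q * (j * (p + q))
  e₁ = solve-∀
  b[a+c]≡ac : b * (a + c) ≡ a * c
  b[a+c]≡ac = begin
    b * (a + c)                                        ≡⟨ cong (_* (a + c)) (C-absorption n′ j) ⟨
    suc j * (n C suc j) * (a + c)                      ≡⟨ e₁ (suc n) (suc j) (n C j) (n C suc j) ⟩
    c * (suc j * ((n C j) + (n C suc j)))              ≡⟨ cong (λ u → c * (suc j * u)) (nCk+nC[k+1]≡[n+1]C[k+1] n j) ⟩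
    c * (suc j * (suc n C suc j))                      ≡⟨ cong (c *_) (C-absorption n j) ⟩
    c * a                                              ≡⟨ *-comm c a ⟩
    a * c                                              ∎
  e₃ : ∀ x a c → (x * c + x * a) * a ≡ x * a * (a + c)
  e₃ = solve-∀
  e₄ : ∀ y a c → y * (a * c) ≡ y * c * a
  e₄ = solve-∀
  x*c+M≡yc : x * c + M ≡ y * c
  x*c+M≡yc = *-cancelʳ-≡ _ _ a (begin
    (x * c + M) * a        ≡⟨ cong (λ m → (x * c + m) * a) M≡xa ⟩
    (x * c + x * a) * a    ≡⟨ e₃ x a c ⟩
    x * a * (a + c)        ≡⟨ cong (_* (a + c)) (trans (sym M≡xa) M≡yb) ⟩
    y * b * (a + c)        ≡⟨ *-assoc y b (a + c) ⟩
    y * (b * (a + c))      ≡⟨ cong (y *_) b[a+c]≡ac ⟩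
    y * (a * c)            ≡⟨ e₄ y a c ⟩
    y * c * a              ∎)

-- By absorption the step from j to j + 1 multiplies the binomial by (m + j + 1) / (j + 1), which is
-- at least 2 while j < m.
2^≤C : ∀ j m → j ≤ m → 2 ^ j ≤ (m + j) C j
2^≤C zero    m _   = ≤-refl
2^≤C (suc j) m j<m = *-cancelˡ-≤ (suc j) (begin
  suc j * (2 * 2 ^ j)                  ≡⟨ e (suc j) (2 ^ j) ⟩
  (suc j + suc j) * 2 ^ j              ≤⟨ *-mono-≤ (+-monoˡ-≤ (suc j) j<m) (2^≤C j m (<⇒≤ j<m)) ⟩
  (m + suc j) * ((m + j) C j)          ≡⟨ cong (_* ((m + j) C j)) (+-suc m j) ⟩
  suc (m + j) * ((m + j) C j)          ≡⟨ C-absorption (m + j) j ⟨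
  suc j * (suc (m + j) C suc j)        ≡⟨ cong (λ u → suc j * (u C suc j)) (+-suc m j) ⟨
  suc j * ((m + suc j) C suc j)        ∎)
  where
  open ≤-Reasoning
  e : ∀ a b → a * (2 * b) ≡ (a + a) * b
  e = solve-∀

-- The entry (2n+1) C(2n, n) of the harmonic triangle is at least 2^n and divides a common multiple
-- of 1, ..., 2n+1 whose size is at most 2n+1 to the number of primes up to 2n+1.
2^≤power-of-π : ∀ n → 2 ^ n ≤ suc (n + n) ^ ∑ (suc (suc (n + n))) π
2^≤power-of-π n with commonMultiple {suc (n + n)} (s≤s z≤n)
... | M , 1≤M , M≤ , h = begin
  2 ^ n                              ≤⟨ 2^≤C n n ≤-refl ⟩
  (n + n) C n                        ≤⟨ m≤n*m _ (suc (n + n)) ⟩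
  suc (n + n) * ((n + n) C n)        ≤⟨ ∣⇒≤ {{>-nonZero 1≤M}} (leibniz-∣ 1≤M h n (n + n) (m≤m+n n n) ≤-refl) ⟩
  M                                  ≤⟨ M≤ ⟩
  suc (n + n) ^ ∑ (suc (suc (n + n))) π ∎
  where open ≤-Reasoning

π-lower : ∀ y → 2 ^ y ≤ 1 + suc y * ∑ (2 ^ suc y) π
π-lower y with 2 ^ y in eq | 1≤2^ y
-- Here n = 2^y - 1, so the 2n + 2 of `2^≤power-of-π` is exactly 2^(y+1), and the claim follows by
-- comparing exponents of 2.
... | suc n | _ = s≤s (≮⇒≥ (λ lt → <⇒≱ (^-monoʳ-< 2 (s≤s (s≤s z≤n)) lt) (begin
  2 ^ n                                        ≤⟨ 2^≤power-of-π n ⟩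
  suc (n + n) ^ ∑ (suc (suc (n + n))) π        ≤⟨ ^-monoˡ-≤ (∑ (suc (suc (n + n))) π) (≤-trans (n≤1+n _) (≤-reflexive 2n+2≡)) ⟩
  (2 ^ suc y) ^ ∑ (suc (suc (n + n))) π        ≡⟨ ^-*-assoc 2 (suc y) (∑ (suc (suc (n + n))) π) ⟩
  2 ^ (suc y * ∑ (suc (suc (n + n))) π)        ≡⟨ cong (λ t → 2 ^ (suc y * ∑ t π)) (trans 2n+2≡ (cong (2 *_) eq)) ⟩
  2 ^ (suc y * ∑ (2 * suc n) π)                ∎)))
  where
  open ≤-Reasoning
  2n+2≡ : suc (suc (n + n)) ≡ 2 ^ suc y
  2n+2≡ = trans (e n) (cong (2 *_) (sym eq))
    where
    e : ∀ n → suc (suc (n + n)) ≡ 2 * suc n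
    e = solve-∀

-- Counting rough numbers

-- Chebyshev's function in binary logarithms, over the primes K ≤ p < 2^y only.
θ : ℕ → ℕ → ℕ
θ K y = ∑ (2 ^ y) (λ p → 𝟙 (K ≤? p) * (π p * lg p))

-- Below K + 2^h all numbers are counted as if prime; from there on p ≥ K and `lg p` ≥ h, so h per
-- prime is covered by `θ`.
π≤θ : ∀ K y h → K + 2 ^ h ≤ 2 ^ y → h * ∑ (2 ^ y) π ≤ h * (K + 2 ^ h) + θ K y
π≤θ K y h B≤ = begin
  h * ∑ (2 ^ y) π                                        ≡⟨ cong (λ n → h * ∑ n π) (m+[n∸m]≡n B≤) ⟨
  h * ∑ (B + r) π                                        ≡⟨ cong (h *_) (∑-+ B r π) ⟩
  h * (∑ B π + ∑ r (λ i → π (B + i)))                    ≡⟨ *-distribˡ-+ h (∑ B π) _ ⟩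
  h * ∑ B π + h * ∑ r (λ i → π (B + i))                  ≤⟨ +-mono-≤ (*-monoʳ-≤ h ∑π≤) (≤-reflexive (sym (∑-*ˡ r h _))) ⟩
  h * B + ∑ r (λ i → h * π (B + i))                      ≤⟨ +-monoʳ-≤ (h * B) (∑-mono r (λ i _ → large i)) ⟩
  h * B + ∑ r (λ i → t (B + i))                          ≤⟨ +-monoʳ-≤ (h * B) (m≤n+m _ (∑ B t)) ⟩
  h * B + (∑ B t + ∑ r (λ i → t (B + i)))                ≡⟨ cong (h * B +_) (∑-+ B r t) ⟨
  h * B + ∑ (B + r) t                                    ≡⟨ cong (λ n → h * B + ∑ n t) (m+[n∸m]≡n B≤) ⟩
  h * B + θ K y                                          ∎
  where
  open ≤-Reasoning
  B = K + 2 ^ h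
  r = 2 ^ y ∸ B
  t : ℕ → ℕ
  t p = 𝟙 (K ≤? p) * (π p * lg p)
  ∑π≤ : ∑ B π ≤ B
  ∑π≤ = ≤-trans (∑-mono B (λ p _ → 𝟙≤1 (prime? p))) (≤-reflexive (trans (∑-const B 1) (*-identityʳ B)))
  large : ∀ i → h * π (B + i) ≤ t (B + i)
  large i = begin
    h * π (B + i)             ≡⟨ *-comm h (π (B + i)) ⟩
    π (B + i) * h             ≤⟨ *-monoʳ-≤ (π (B + i)) (2^≤⇒≤lg (≤-trans (m≤n+m (2 ^ h) K) (m≤m+n B i))) ⟩
    π (B + i) * lg (B + i)    ≤⟨ ≤-𝟙-* (K ≤? B + i) (≤-trans (m≤m+n K (2 ^ h)) (m≤m+n B i)) _ ⟩
    t (B + i)                 ∎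

linear≤2^ : ∀ i → 64 * (10 + i) + 48 ≤ 2 ^ (10 + i)
linear≤2^ zero    = from-yes (688 ≤? 1024)
linear≤2^ (suc i) = begin
  64 * (11 + i) + 48                 ≡⟨ e i ⟩
  (64 * (10 + i) + 48) + 64          ≤⟨ +-mono-≤ (linear≤2^ i) (2^-mono {6} {10 + i} (from-yes (6 ≤? 6 + (4 + i)))) ⟩
  2 ^ (10 + i) + 2 ^ (10 + i)        ≡⟨ cong (2 ^ (10 + i) +_) (+-identityʳ (2 ^ (10 + i))) ⟨
  2 ^ (11 + i)                       ∎
  where
  open ≤-Reasoning
  e : ∀ i → 64 * (11 + i) + 48 ≡ (64 * (10 + i) + 48) + 64
  e = solve-∀

-- With h near y/2, the numbers below K + 2^h that `π≤θ` gives away cost little: K is small by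
-- hypothesis and 2^h is about the square root of 2^y. From y ≥ 20 comes h ≥ 10, where `linear≤2^`
-- applies.
θ-lower : ∀ K y → 20 ≤ y → 32 * (y * K) ≤ 2 ^ y → 2 ^ y ≤ 8 * θ K y
-- Eight copies of 2^y are estimated at once; the error terms use up two of them, and the other six
-- are at most 48 `θ K y`.
θ-lower K y@(suc y′) 20≤y yK≤ = *-cancelˡ-≤ 6 (+-cancelˡ-≤ (2 * 2 ^ y) _ _ (begin
  2 * 2 ^ y + 6 * 2 ^ y                                  ≡⟨ e₁ (2 ^ y′) ⟩
  16 * 2 ^ y′                                            ≤⟨ *-monoʳ-≤ 16 (π-lower y′) ⟩
  16 * (1 + y * P)                                       ≤⟨ *-monoʳ-≤ 16 (+-monoʳ-≤ 1 (begin
    y * P                                                  ≤⟨ *-monoˡ-≤ P y≤3h ⟩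
    3 * h * P                                              ≡⟨ *-assoc 3 h P ⟩
    3 * (h * P)                                            ≤⟨ *-monoʳ-≤ 3 (π≤θ K y h B≤) ⟩
    3 * (h * B + θ K y)                                    ≡⟨ e₂ h B (θ K y) ⟩
    (h + (h + h)) * B + 3 * θ K y                          ≤⟨ +-monoˡ-≤ (3 * θ K y) (*-monoˡ-≤ B (≤-trans (+-monoʳ-≤ h 2h≤y) (+-monoˡ-≤ y (≤-trans (m≤m+n h h) 2h≤y)))) ⟩
    (y + y) * B + 3 * θ K y                                ∎)) ⟩
  16 * (1 + ((y + y) * (K + 2 ^ h) + 3 * θ K y))         ≡⟨ e₃ y K (2 ^ h) (θ K y) ⟩
  32 * (y * K) + (32 * (y * 2 ^ h) + 16) + 48 * θ K y    ≤⟨ +-monoˡ-≤ (48 * θ K y) (+-mono-≤ yK≤ y2^h≤) ⟩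
  2 ^ y + 2 ^ y + 48 * θ K y                             ≡⟨ e₄ (2 ^ y) (θ K y) ⟩
  2 * 2 ^ y + 6 * (8 * θ K y)                            ∎))
  where
  open ≤-Reasoning
  h = ⌊ y /2⌋
  B = K + 2 ^ h
  P = ∑ (2 ^ y) π
  e₁ : ∀ t → 2 * (2 * t) + 6 * (2 * t) ≡ 16 * t
  e₁ = solve-∀
  e₂ : ∀ h B t → 3 * (h * B + t) ≡ (h + (h + h)) * B + 3 * t
  e₂ = solve-∀
  e₃ : ∀ y K s t → 16 * (1 + ((y + y) * (K + s) + 3 * t)) ≡ 32 * (y * K) + (32 * (y * s) + 16) + 48 * t
  e₃ = solve-∀
  e₄ : ∀ u t → u + u + 48 * t ≡ 2 * u + 6 * (8 * t)
  e₄ = solve-∀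
  e₅ : ∀ h s → 32 * ((1 + (h + h)) * s) + 16 * s ≡ s * (64 * h + 48)
  e₅ = solve-∀
  10≤h : 10 ≤ h
  10≤h = ⌊n/2⌋-mono 20≤y
  2h≤y : h + h ≤ y
  2h≤y = ≤-trans (+-monoʳ-≤ h (⌊n/2⌋≤⌈n/2⌉ y)) (≤-reflexive (⌊n/2⌋+⌈n/2⌉≡n y))
  ceil≤ : ∀ n → ⌈ n /2⌉ ≤ suc ⌊ n /2⌋
  ceil≤ zero          = z≤n
  ceil≤ (suc zero)    = s≤s z≤n
  ceil≤ (suc (suc n)) = s≤s (ceil≤ n)
  y≤1+2h : y ≤ 1 + (h + h)
  y≤1+2h = ≤-trans (≤-reflexive (sym (⌊n/2⌋+⌈n/2⌉≡n y))) (≤-trans (+-monoʳ-≤ h (ceil≤ y)) (≤-reflexive (+-suc h h)))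
  y≤3h : y ≤ 3 * h
  y≤3h = ≤-trans y≤1+2h (+-mono-≤ (≤-trans (s≤s z≤n) 10≤h) (+-monoʳ-≤ h (≤-reflexive (sym (+-identityʳ h)))))
  64h+48≤ : 64 * h + 48 ≤ 2 ^ h
  64h+48≤ = subst (λ h → 64 * h + 48 ≤ 2 ^ h) (m+[n∸m]≡n 10≤h) (linear≤2^ (h ∸ 10))
  y2^h≤ : 32 * (y * 2 ^ h) + 16 ≤ 2 ^ y
  y2^h≤ = begin
    32 * (y * 2 ^ h) + 16                             ≤⟨ +-mono-≤ (*-monoʳ-≤ 32 (*-monoˡ-≤ (2 ^ h) y≤1+2h)) (*-monoʳ-≤ 16 (1≤2^ h)) ⟩
    32 * ((1 + (h + h)) * 2 ^ h) + 16 * 2 ^ h         ≡⟨ e₅ h (2 ^ h) ⟩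
    2 ^ h * (64 * h + 48)                             ≤⟨ *-monoʳ-≤ (2 ^ h) 64h+48≤ ⟩
    2 ^ h * 2 ^ h                                     ≡⟨ ^-distribˡ-+-* 2 h h ⟨
    2 ^ (h + h)                                       ≤⟨ 2^-mono 2h≤y ⟩
    2 ^ y                                             ∎
  B≤ : B ≤ 2 ^ y
  B≤ = *-cancelˡ-≤ 2 (begin
    2 * (K + 2 ^ h)              ≡⟨ *-distribˡ-+ 2 K (2 ^ h) ⟩
    2 * K + 2 * 2 ^ h            ≤⟨ +-mono-≤ (*-mono-≤ {2} {32} (from-yes (2 ≤? 32)) (m≤n*m K y)) (*-mono-≤ {2} {32} (from-yes (2 ≤? 32)) (m≤n*m (2 ^ h) y)) ⟩
    32 * (y * K) + 32 * (y * 2 ^ h)        ≤⟨ +-mono-≤ yK≤ (≤-trans (m≤m+n _ 16) y2^h≤) ⟩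
    2 ^ y + 2 ^ y                ≡⟨ cong (2 ^ y +_) (+-identityʳ (2 ^ y)) ⟨
    2 * 2 ^ y                    ∎)

rough-* : ∀ {K p e} → Prime p → K ≤ p → IsRough K e → IsRough K (p * e)
rough-* {K} {p} {e} pp K≤p (1≤e , rough) = *-mono-≤ (<⇒≤ (prime>1 pp)) 1≤e ,
  λ { (hasNonTrivialDivisor {d} {{nt}} d<K d∣pe) → rough (hasNonTrivialDivisor {{nt}} d<K
    (coprime-divisor (Coprimality.sym (prime⇒coprime pp {{nonTrivial⇒nonZero d {{nt}}}} (<-≤-trans d<K K≤p))) d∣pe)) }

-- Restricts log d = ∑ Λ(q) over q ∣ d to the rough d < 2^x and to prime q ≥ K, then puts d = p e.
∑-rough-θ≤ : ∀ K x z → z < x →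
  ∑ (2 ^ z) (λ e → ρ K e * θ K (x ∸ suc (lg e))) ≤ x * ∑ (2 ^ x) (ρ K)
∑-rough-θ≤ K x z z<x = begin
  ∑ (2 ^ z) (λ e → ρ K e * θ K (x ∸ suc (lg e)))
    ≤⟨ ∑-mono (2 ^ z) (λ e e< → 𝟙-*-≤ (isRough? K e) (λ re → multiply e e< re)) ⟩
  ∑ (2 ^ z) (λ e → ∑ X (λ p → ∑ X (λ d → 𝟙 (p * e ≟ d) * A d p)))
    ≤⟨ ∑-≤-length _ (2^-mono (<⇒≤ z<x)) ⟩
  ∑ X (λ e → ∑ X (λ p → ∑ X (λ d → 𝟙 (p * e ≟ d) * A d p)))
    ≡⟨ ∑-cong X (λ e _ → ∑-swap X X _) ⟩
  ∑ X (λ e → ∑ X (λ d → ∑ X (λ p → 𝟙 (p * e ≟ d) * A d p)))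
    ≡⟨ ∑-swap X X _ ⟩
  ∑ X (λ d → ∑ X (λ e → ∑ X (λ p → 𝟙 (p * e ≟ d) * A d p)))
    ≡⟨ ∑-cong X (λ d _ → ∑-swap X X _) ⟩
  ∑ X (λ d → ∑ X (λ p → ∑ X (λ e → 𝟙 (p * e ≟ d) * A d p)))
    ≤⟨ ∑-mono X (λ d _ → ∑-mono X (λ p _ → cofactor d p)) ⟩
  ∑ X (λ d → ∑ X (A d))
    ≡⟨ ∑-cong X (λ d _ → ∑-*ˡ X (ρ K d) _) ⟩
  ∑ X (λ d → ρ K d * ∑ X (λ p → π p * (𝟙 (p ∣? d) * lg p)))
    ≤⟨ ∑-mono X (λ d d<X → 𝟙-*-mono (isRough? K d) (λ { (1≤d , _) →
         ≤-trans (∑-lg-prime-divisors X 1≤d) (<⇒≤ (<2^⇒lg< 1≤d d<X)) })) ⟩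
  ∑ X (λ d → ρ K d * x)
    ≡⟨ trans (∑-*ʳ X x (ρ K)) (*-comm _ x) ⟩
  x * ∑ X (ρ K) ∎
  where
  open ≤-Reasoning
  X = 2 ^ x
  A : ℕ → ℕ → ℕ
  A d p = ρ K d * (π p * (𝟙 (p ∣? d) * lg p))
  multiply : ∀ e → e < 2 ^ z → IsRough K e →
    θ K (x ∸ suc (lg e)) ≤ ∑ X (λ p → ∑ X (λ d → 𝟙 (p * e ≟ d) * A d p))
  multiply e e< re@(1≤e , _) = ≤-trans
    (∑-mono (2 ^ (x ∸ suc (lg e))) (λ p p< → 𝟙-*-≤ (K ≤? p) (λ K≤p → 𝟙-*-≤ (prime? p) (λ pp → begin
      lg p                                            ≤⟨ ≤-𝟙-* (p ∣? p * e) (m∣m*n e) (lg p) ⟩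
      𝟙 (p ∣? p * e) * lg p                           ≤⟨ ≤-𝟙-* (prime? p) pp _ ⟩
      π p * (𝟙 (p ∣? p * e) * lg p)                   ≤⟨ ≤-𝟙-* (isRough? K (p * e)) (rough-* pp K≤p re) _ ⟩
      A (p * e) p                                     ≤⟨ ≤-𝟙-* (p * e ≟ p * e) refl _ ⟩
      𝟙 (p * e ≟ p * e) * A (p * e) p                 ≤⟨ term≤∑ (λ d → 𝟙 (p * e ≟ d) * A d p) (pe< p p<) ⟩
      ∑ X (λ d → 𝟙 (p * e ≟ d) * A d p)               ∎))))
    (∑-≤-length _ (2^-mono (m∸n≤m x (suc (lg e)))))
    where
    -- The exponent `x ∸ suc (lg e)` is chosen so that p e < 2^x, because e < 2^(lg e + 1).
    pe< : ∀ p → p < 2 ^ (x ∸ suc (lg e)) → p * e < X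
    pe< p p< = begin-strict
      p * e                                           ≤⟨ *-monoʳ-≤ p (<⇒≤ (n<2^[1+lg] e)) ⟩
      p * 2 ^ suc (lg e)                              <⟨ *-monoˡ-< (2 ^ suc (lg e)) {{2^n≢0 (suc (lg e))}} p< ⟩
      2 ^ (x ∸ suc (lg e)) * 2 ^ suc (lg e)           ≡⟨ ^-distribˡ-+-* 2 (x ∸ suc (lg e)) (suc (lg e)) ⟨
      2 ^ (x ∸ suc (lg e) + suc (lg e))               ≡⟨ cong (2 ^_) (m∸n+n≡m (≤-trans (<2^⇒lg< 1≤e e<) (<⇒≤ z<x))) ⟩
      X                                               ∎
  vanish : ∀ d p {a b} → a ≡ 0 → ∑ X (λ e → 𝟙 (p * e ≟ d) * a) ≤ b
  vanish d p refl = ≤-trans (≤-reflexive (trans (∑-cong X (λ e _ → *-zeroʳ (𝟙 (p * e ≟ d)))) (∑-zero X))) z≤n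
  -- Given d and p, at most the one e = d / p contributes, and only if p is a prime dividing d.
  cofactor : ∀ d p → ∑ X (λ e → 𝟙 (p * e ≟ d) * A d p) ≤ A d p
  cofactor d p with prime? p | p ∣? d
  ... | no _   | _      = vanish d p (*-zeroʳ (ρ K d))
  ... | yes _  | no _   = vanish d p (*-zeroʳ (ρ K d))
  ... | yes pp | yes (divides c d≡cp) = ≤-trans
    (∑-mono X (λ e _ → *-monoˡ-≤ _ (𝟙-mono (p * e ≟ d) (c ≟ e) (λ pe≡d →
      sym (*-cancelˡ-≡ e c p {{prime⇒nonZero pp}} (trans pe≡d (trans d≡cp (*-comm c p))))))))
    (∑-𝟙≡-≤ X c (λ _ → ρ K d * (1 * (1 * lg p))) (λ _ → ≤-refl))

module _ (l : ℕ) where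
  private
    ℓ = suc l
    K = 2 ^ ℓ

  -- `2 ^ threshold` is K log K up to a constant: from this exponent on `θ-lower` applies. The 20
  -- serves its condition 20 ≤ y and absorbs the constants.
  threshold : ℕ
  threshold = ℓ + (lg ℓ + 20)

  private
    open ≤-Reasoning

    θ-condition : ∀ y → threshold ≤ y → 20 ≤ y × 32 * (y * K) ≤ 2 ^ y
    θ-condition y t≤y = ≤-trans (m≤n+m 20 (ℓ + lg ℓ)) (≤-trans (≤-reflexive (+-assoc ℓ (lg ℓ) 20)) t≤y) ,
      subst (λ y → 32 * (y * K) ≤ 2 ^ y) (m+[n∸m]≡n t≤y) (core (y ∸ threshold))
      where
      core : ∀ v → 32 * ((threshold + v) * K) ≤ 2 ^ (threshold + v)
      core v = begin
        32 * ((ℓ + (lg ℓ + 20) + v) * K)                    ≡⟨ e₁ ℓ (lg ℓ) v K ⟩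
        32 * (ℓ + (lg ℓ + (20 + v))) * K                    ≤⟨ *-monoˡ-≤ K (*-monoʳ-≤ 32 (+-mono-≤ (<⇒≤ (n<2^[1+lg] ℓ)) (+-mono-≤ (<⇒≤ (n<2^n (lg ℓ))) (+-monoʳ-≤ 20 (<⇒≤ (n<2^n v)))))) ⟩
        -- Each summand is at most its coefficient times a b; the coefficients sum to 24, and 32 ·
        -- 24 = 768.
        32 * (2 * a + (a + (20 + b))) * K                   ≤⟨ *-monoˡ-≤ K (*-monoʳ-≤ 32 (+-mono-≤ (*-monoʳ-≤ 2 a≤ab) (+-mono-≤ a≤ab (+-mono-≤ (*-monoʳ-≤ 20 1≤ab) b≤ab)))) ⟩
        32 * (2 * (a * b) + ((a * b) + (20 * (a * b) + (a * b)))) * K       ≡⟨ e₂ (a * b) K ⟩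
        768 * (a * b * K)                                   ≤⟨ *-monoˡ-≤ (a * b * K) (≤-trans (from-yes (768 ≤? 1024)) (2^-mono {10} {20} (from-yes (10 ≤? 20)))) ⟩
        2 ^ 20 * (a * b * K)                                ≡⟨ e₃ a b K (2 ^ 20) ⟩
        K * (a * 2 ^ 20) * b                                ≡⟨ cong (λ u → K * u * b) (^-distribˡ-+-* 2 (lg ℓ) 20) ⟨
        K * 2 ^ (lg ℓ + 20) * b                             ≡⟨ cong (_* b) (^-distribˡ-+-* 2 ℓ (lg ℓ + 20)) ⟨
        2 ^ threshold * b                                   ≡⟨ ^-distribˡ-+-* 2 threshold v ⟨
        2 ^ (threshold + v)                                 ∎
        where
        a = 2 ^ lg ℓ
        b = 2 ^ v
        a≤ab : a ≤ a * b
        a≤ab = m≤m*n a b {{2^n≢0 v}}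
        b≤ab : b ≤ a * b
        b≤ab = m≤n*m b a {{2^n≢0 (lg ℓ)}}
        1≤ab : 1 ≤ a * b
        1≤ab = *-mono-≤ (1≤2^ (lg ℓ)) (1≤2^ v)
        e₁ : ∀ ℓ g v K → 32 * ((ℓ + (g + 20) + v) * K) ≡ 32 * (ℓ + (g + (20 + v))) * K
        e₁ = solve-∀
        e₂ : ∀ c K → 32 * (2 * c + (c + (20 * c + c))) * K ≡ 768 * (c * K)
        e₂ = solve-∀
        e₃ : ∀ a b K t → t * (a * b * K) ≡ K * (a * t) * b
        e₃ = solve-∀

    threshold≤ : threshold ≤ 32 * ℓ
    threshold≤ = begin
      ℓ + (lg ℓ + 20)           ≤⟨ +-monoʳ-≤ ℓ (+-mono-≤ (<⇒≤ (<2^⇒lg< {ℓ} {ℓ} (s≤s z≤n) (n<2^n ℓ))) (*-monoʳ-≤ 20 (s≤s (z≤n {l})))) ⟩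
      ℓ + (ℓ + 20 * ℓ)          ≡⟨ e ℓ ⟩
      22 * ℓ                    ≤⟨ *-monoˡ-≤ ℓ (from-yes (22 ≤? 32)) ⟩
      32 * ℓ                    ∎
      where
      e : ∀ ℓ → ℓ + (ℓ + 20 * ℓ) ≡ 22 * ℓ
      e = solve-∀

  -- Split x as `threshold` + z and bound both shares of x · 2^x. The share of z uses the harmonic
  -- sum over rough e < 2^z; the share of `threshold`, which that sum does not reach when z is
  -- small, uses the term e = 1 alone.
  rough-count : ∀ x → threshold < x → 2 ^ x ≤ 1024 * ℓ * ∑ (2 ^ x) (ρ K)
  rough-count x t<x = *-cancelˡ-≤ x {{>-nonZero (≤-<-trans z≤n t<x)}} (begin
    x * 2 ^ x
      ≡⟨ cong (_* 2 ^ x) x≡ ⟨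
    (y₀ + z) * 2 ^ x
      ≡⟨ *-distribʳ-+ (2 ^ x) y₀ z ⟩
    y₀ * 2 ^ x + z * 2 ^ x
      ≤⟨ +-mono-≤ (*-mono-≤ threshold≤ 2^x≤) z2^x≤ ⟩
    32 * ℓ * (16 * (x * Φ)) + 32 * ℓ * (16 * (x * Φ))
      ≡⟨ e₁ ℓ x Φ ⟩
    x * (1024 * ℓ * Φ) ∎)
    where
    y₀ = threshold
    z = x ∸ y₀
    Z = 2 ^ z
    Φ = ∑ (2 ^ x) (ρ K)
    E = ∑ Z (λ e → ρ K e * W z e)
    e₁ : ∀ ℓ x p → 32 * ℓ * (16 * (x * p)) + 32 * ℓ * (16 * (x * p)) ≡ x * (1024 * ℓ * p)
    e₁ = solve-∀
    x≡ : y₀ + z ≡ x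
    x≡ = m+[n∸m]≡n (<⇒≤ t<x)
    1≤z : 1 ≤ z
    1≤z = m<n⇒0<n∸m t<x
    2^x≡ : 2 ^ x ≡ 2 ^ y₀ * Z
    2^x≡ = trans (cong (2 ^_) (sym x≡)) (^-distribˡ-+-* 2 y₀ z)
    -- As e < 2^z, the exponent left for p is at least `threshold`; the 1 lost in `suc (lg e)`
    -- doubles the 8 of `θ-lower`.
    θ≥ : ∀ e → e < Z → 1 ≤ e → 2 ^ y₀ * W z e ≤ 16 * θ K (x ∸ suc (lg e))
    θ≥ e e< 1≤e = begin
      2 ^ y₀ * W z e                       ≡⟨ cong (2 ^ y₀ *_) (W-pos z 1≤e) ⟩
      2 ^ y₀ * 2 ^ (z ∸ lg e)              ≡⟨ ^-distribˡ-+-* 2 y₀ (z ∸ lg e) ⟨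
      2 ^ (y₀ + (z ∸ lg e))                ≡⟨ cong (2 ^_) exponent ⟩
      2 ^ suc (x ∸ suc (lg e))             ≤⟨ *-monoʳ-≤ 2 (θ-lower K _ (proj₁ cond) (proj₂ cond)) ⟩
      2 * (8 * θ K (x ∸ suc (lg e)))       ≡⟨ *-assoc 2 8 (θ K (x ∸ suc (lg e))) ⟨
      16 * θ K (x ∸ suc (lg e))            ∎
      where
      lge<z : lg e < z
      lge<z = <2^⇒lg< 1≤e e<
      exponent : y₀ + (z ∸ lg e) ≡ suc (x ∸ suc (lg e))
      exponent = trans (sym (+-∸-assoc y₀ (<⇒≤ lge<z))) (trans (cong (_∸ lg e) x≡)
        (+-∸-assoc 1 (≤-trans lge<z (≤-trans (m≤n+m z y₀) (≤-reflexive x≡)))))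
      cond = θ-condition (x ∸ suc (lg e)) (s≤s⁻¹ (≤-trans (≤-trans (≤-reflexive (+-comm 1 y₀)) (+-monoʳ-≤ y₀ (m<n⇒0<n∸m lge<z))) (≤-reflexive exponent)))
    2^yE≤ : 2 ^ y₀ * E ≤ 16 * (x * Φ)
    2^yE≤ = begin
      2 ^ y₀ * E
        ≡⟨ ∑-*ˡ Z (2 ^ y₀) _ ⟨
      ∑ Z (λ e → 2 ^ y₀ * (ρ K e * W z e))
        ≤⟨ ∑-mono Z (λ e e< → ≤-trans (≤-reflexive (x∙yz≈y∙xz (2 ^ y₀) (ρ K e) (W z e)))
             (𝟙-*-mono (isRough? K e) (λ { (1≤e , _) → θ≥ e e< 1≤e }))) ⟩
      ∑ Z (λ e → ρ K e * (16 * θ K (x ∸ suc (lg e))))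
        ≡⟨ trans (∑-cong Z (λ e _ → x∙yz≈y∙xz (ρ K e) 16 _)) (∑-*ˡ Z 16 _) ⟩
      16 * ∑ Z (λ e → ρ K e * θ K (x ∸ suc (lg e)))
        ≤⟨ *-monoʳ-≤ 16 (∑-rough-θ≤ K x z z<x) ⟩
      16 * (x * Φ) ∎
      where
      z<x : z < x
      z<x = subst (z <_) x≡ (m<n+m z (s≤s z≤n))
    Z≤E : Z ≤ E
    Z≤E = ≤-trans (≤-𝟙-* (isRough? K 1) (≤-refl , rough-1 K) Z)
      (term≤∑ (λ e → ρ K e * W z e) (≤-<-trans 1≤z (n<2^n z)))
    2^x≤ : 2 ^ x ≤ 16 * (x * Φ)
    2^x≤ = ≤-trans (≤-reflexive 2^x≡) (≤-trans (*-monoʳ-≤ (2 ^ y₀) Z≤E) 2^yE≤)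
    z2^x≤ : z * 2 ^ x ≤ 32 * ℓ * (16 * (x * Φ))
    z2^x≤ = begin
      z * 2 ^ x                     ≡⟨ trans (cong (z *_) 2^x≡) (x∙yz≈y∙xz z (2 ^ y₀) Z) ⟩
      2 ^ y₀ * (z * Z)              ≤⟨ *-monoʳ-≤ (2 ^ y₀) (∑-W-rough l z) ⟩
      2 ^ y₀ * (32 * ℓ * E)         ≡⟨ x∙yz≈y∙xz (2 ^ y₀) (32 * ℓ) E ⟩
      32 * ℓ * (2 ^ y₀ * E)         ≤⟨ *-monoʳ-≤ (32 * ℓ) 2^yE≤ ⟩
      32 * ℓ * (16 * (x * Φ))       ∎

-- Rainbow progressions

enumerate : ∀ {P : ℕ → Set} (P? : ∀ i → Dec (P i)) X →
  ∃ λ (g : Fin (∑ X (λ i → 𝟙 (P? i))) → ℕ) → (∀ j → g j < X × P (g j)) × Injective _≡_ _≡_ g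
enumerate P? zero = (λ ()) , (λ ()) , λ { {()} }
enumerate {P} P? (suc X) with enumerate P? X | P? X
... | g , g-props , g-inj | d = g′ d ∘ splitAt s ,
  (λ j → g′-props d (splitAt s j)) ,
  λ {i} {j} eq → trans (sym (Fin.join-splitAt s _ i)) (trans (cong (join s _) (g′-inj d (splitAt s i) (splitAt s j) eq)) (Fin.join-splitAt s _ j))
  where
  s = ∑ X (λ i → 𝟙 (P? i))
  g′ : (d : Dec (P X)) → Fin s ⊎ Fin (𝟙 d) → ℕ
  g′ d = [ g , const X ]′
  g′-props : ∀ d u → g′ d u < suc X × P (g′ d u)
  g′-props d       (inj₁ j) = m<n⇒m<1+n (proj₁ (g-props j)) , proj₂ (g-props j)
  g′-props (yes p) (inj₂ _) = ≤-refl , p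
  g′-inj : ∀ d u v → g′ d u ≡ g′ d v → u ≡ v
  g′-inj d       (inj₁ i) (inj₁ j) eq = cong inj₁ (g-inj eq)
  g′-inj d       (inj₁ i) (inj₂ _) eq = contradiction (proj₁ (g-props i)) (<-irrefl eq)
  g′-inj d       (inj₂ _) (inj₁ j) eq = contradiction (proj₁ (g-props j)) (<-irrefl (sym eq))
  g′-inj (yes _) (inj₂ Fin.zero) (inj₂ Fin.zero) eq = refl

rough-coprime : ∀ {K d t} → IsRough K d → 1 ≤ t → t < K → Coprime d t
rough-coprime (1≤d , rough) 1≤t t<K {zero}          (_   , 0∣t) = contradiction 1≤t (<-irrefl (sym (0∣⇒≡0 0∣t)))
rough-coprime (1≤d , rough) 1≤t t<K {suc zero}      _           = refl
rough-coprime (1≤d , rough) 1≤t t<K {suc (suc c)}   (c∣d , c∣t) =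
  contradiction (hasNonTrivialDivisor (≤-<-trans (∣⇒≤ {{>-nonZero 1≤t}} c∣t) t<K) c∣d) rough

-- A number has at most one factorisation t d with t < K and d K-rough, t being its K-smooth part.
rough-cofactor-unique : ∀ {K d₁ d₂ t₁ t₂} → IsRough K d₁ → IsRough K d₂ →
  1 ≤ t₁ → t₁ < K → 1 ≤ t₂ → t₂ < K → t₁ * d₁ ≡ t₂ * d₂ → d₁ ≡ d₂
rough-cofactor-unique {K} {d₁} {d₂} {t₁} {t₂} r₁ r₂ 1≤t₁ t₁< 1≤t₂ t₂< eq = ∣-antisym
  (coprime-divisor (rough-coprime r₁ 1≤t₂ t₂<) (divides t₁ (sym eq)))
  (coprime-divisor (rough-coprime r₂ 1≤t₁ t₁<) (divides t₂ eq))

-- The two shared points differ by (i₁ - i) d₁ = (i₂ - i) d₂, with both cofactors positive and below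
-- K, so `rough-cofactor-unique` gives the difference; the common position i then gives the start.
progression-unique : ∀ {K d₁ d₂ a₁ a₂ i j i₁ i₂} → IsRough K d₁ → IsRough K d₂ →
  i ≡ j → i < i₁ → i₁ < K → j < i₂ → i₂ < K →
  a₁ + i * d₁ ≡ a₂ + j * d₂ → a₁ + i₁ * d₁ ≡ a₂ + i₂ * d₂ → d₁ ≡ d₂ × a₁ ≡ a₂
progression-unique {K} {d₁} {d₂} {a₁} {a₂} {i} {_} {i₁} {i₂} r₁ r₂ refl i<i₁ i₁<K i<i₂ i₂<K xs≡ ys≡ = d≡ , a≡
  where
  open ≡-Reasoning
  regroup : ∀ a i t d → a + i * d + t * d ≡ a + (i + t) * d
  regroup = solve-∀
  split : ∀ a d {i′} → i < i′ → a + i * d + (i′ ∸ i) * d ≡ a + i′ * d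
  split a d {i′} i<i′ = trans (regroup a i (i′ ∸ i) d) (cong (λ u → a + u * d) (m+[n∸m]≡n (<⇒≤ i<i′)))
  td≡ : (i₁ ∸ i) * d₁ ≡ (i₂ ∸ i) * d₂
  td≡ = +-cancelˡ-≡ (a₁ + i * d₁) _ _ (begin
    a₁ + i * d₁ + (i₁ ∸ i) * d₁      ≡⟨ split a₁ d₁ i<i₁ ⟩
    a₁ + i₁ * d₁                     ≡⟨ ys≡ ⟩
    a₂ + i₂ * d₂                     ≡⟨ split a₂ d₂ i<i₂ ⟨
    a₂ + i * d₂ + (i₂ ∸ i) * d₂      ≡⟨ cong (_+ (i₂ ∸ i) * d₂) xs≡ ⟨
    a₁ + i * d₁ + (i₂ ∸ i) * d₂      ∎)
  d≡ : d₁ ≡ d₂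
  d≡ = rough-cofactor-unique r₁ r₂ (m<n⇒0<n∸m i<i₁) (≤-<-trans (m∸n≤m i₁ i) i₁<K)
    (m<n⇒0<n∸m i<i₂) (≤-<-trans (m∸n≤m i₂ i) i₂<K) td≡
  a≡ : a₁ ≡ a₂
  a≡ = +-cancelʳ-≡ (i * d₁) _ _ (trans xs≡ (cong (λ d → a₂ + i * d) (sym d≡)))

module _ {n r m} (f : Fin n → Fin r) (atMost : AtMost m f) where

  private
    class : Fin n → List (Fin n)
    class x = filter (λ y → f y Fin.≟ f x) (allFin n)

    ∈class : ∀ x y → f y ≡ f x → y ∈ class x
    ∈class x y = ∈-filter⁺ (λ y → f y Fin.≟ f x) (∈-allFin y)

  -- The place of y in the list of its colour class; the class has at most m members, so m values
  -- suffice to name y once x is known.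
  rank : ∀ x y → f y ≡ f x → Fin m
  rank x y eq = inject≤ (index (∈class x y eq)) (atMost (f x))

  rank-injective : ∀ {x x′} y y′ eq eq′ → x ≡ x′ → rank x y eq ≡ rank x′ y′ eq′ → y ≡ y′
  rank-injective {x} y y′ eq eq′ refl ranks≡ = trans (lookup-index (∈class x y eq))
    (trans (cong (lookup (class x)) (Fin.inject≤-injective _ _ _ _ ranks≡)) (sym (lookup-index (∈class x y′ eq′))))

-- If no progression is rainbow, then a progression with start a and rough difference d has two terms
-- x, y of equal colour, x being its i-th term; (a, d) is determined by i, x and the rank of y in its colour class.
forces-rainbow : ∀ m k K X → 1 ≤ k → 1 ≤ X → k ≤ K → 2 * (k * m) < ∑ X (ρ K) →
  ForcesRainbowAP m k (k * X + k * X)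
forces-rainbow m k K X 1≤k 1≤X k≤K large r f atMost = result
  where
  h = k * X
  n = h + h
  Φ = ∑ X (ρ K)
  enumeration = enumerate (isRough? K) X
  g : Fin Φ → ℕ
  g = proj₁ enumeration
  g<X : ∀ j → g j < X
  g<X j = proj₁ (proj₁ (proj₂ enumeration) j)
  g-rough : ∀ j → IsRough K (g j)
  g-rough j = proj₂ (proj₁ (proj₂ enumeration) j)
  g-injective : Injective _≡_ _≡_ g
  g-injective = proj₂ (proj₂ enumeration)

  term : Fin h → Fin Φ → Fin k → ℕ
  term a j i = toℕ a + toℕ i * g j
  -- The start is below k X and i d ≤ k X, which is why n = 2 k X.
  term<n : ∀ a j i → term a j i < n
  term<n a j i = +-mono-<-≤ (Fin.toℕ<n a) (*-mono-≤ (<⇒≤ (Fin.toℕ<n i)) (<⇒≤ (g<X j)))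
  P : Fin h → Fin Φ → Fin k → Fin n
  P a j i = fromℕ< (term<n a j i)
  toℕ-P : ∀ a j i → toℕ (P a j i) ≡ term a j i
  toℕ-P a j i = Fin.toℕ-fromℕ< (term<n a j i)

  P-injective : ∀ {a₁ j₁ a₂ j₂} i₁ i₂ → P a₁ j₁ i₁ ≡ P a₂ j₂ i₂ → term a₁ j₁ i₁ ≡ term a₂ j₂ i₂
  P-injective i₁ i₂ eq = trans (sym (toℕ-P _ _ i₁)) (trans (cong toℕ eq) (toℕ-P _ _ i₂))

  Collision : Fin h → Fin Φ → Set
  Collision a j = ∃₂ λ i i′ → i Fin.< i′ × f (P a j i′) ≡ f (P a j i)
  collision? : ∀ a j → Dec (Collision a j)
  collision? a j = Fin.any? (λ i → Fin.any? (λ i′ → i Fin.<? i′ ×-dec f (P a j i′) Fin.≟ f (P a j i)))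

  rainbow : ∀ a j → ¬ Collision a j → HasRainbowAP k f
  rainbow a j ¬c = P a j , (suc (toℕ a) , g j , proj₁ (g-rough j) , (λ i → cong suc (toℕ-P a j i))) , injective
    where
    injective : Injective _≡_ _≡_ (f ∘ P a j)
    injective {i} {i′} eq with Fin.<-cmp i i′
    ... | tri< i<i′ _ _ = ⊥-elim (¬c (i , i′ , i<i′ , sym eq))
    ... | tri≈ _ i≡i′ _ = i≡i′
    ... | tri> _ _ i′<i = ⊥-elim (¬c (i′ , i , i′<i , eq))

  code : ∀ a j → Collision a j → Fin (k * (n * m))
  code a j (i , i′ , _ , eq) = combine i (combine (P a j i) (rank f atMost (P a j i) (P a j i′) eq))

  code-injective : ∀ a₁ j₁ a₂ j₂ (c₁ : Collision a₁ j₁) (c₂ : Collision a₂ j₂) →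
    code a₁ j₁ c₁ ≡ code a₂ j₂ c₂ → a₁ ≡ a₂ × j₁ ≡ j₂
  code-injective a₁ j₁ a₂ j₂ (x₁ , y₁ , x<y₁ , eq₁) (x₂ , y₂ , x<y₂ , eq₂) codes≡ =
    Fin.toℕ-injective (proj₂ unique) , g-injective (proj₁ unique)
    where
    positions = Fin.combine-injective x₁ _ x₂ _ codes≡
    points = Fin.combine-injective (P a₁ j₁ x₁) _ (P a₂ j₂ x₂) _ (proj₂ positions)
    unique : g j₁ ≡ g j₂ × toℕ a₁ ≡ toℕ a₂
    unique = progression-unique (g-rough j₁) (g-rough j₂) (cong toℕ (proj₁ positions))
      x<y₁ (<-≤-trans (Fin.toℕ<n y₁) k≤K) x<y₂ (<-≤-trans (Fin.toℕ<n y₂) k≤K)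
      (P-injective x₁ x₂ (proj₁ points))
      (P-injective y₁ y₂ (rank-injective f atMost _ _ eq₁ eq₂ (proj₁ points) (proj₂ points)))

  count : (∀ a j → Collision a j) → h * Φ ≤ k * (n * m)
  count c = Fin.injective⇒≤ {f = λ u → code _ _ (collision u)} (λ {u} {v} eq →
    let both≡ = code-injective _ _ _ _ (collision u) (collision v) eq in
    trans (sym (Fin.combine-remQuot {h} Φ u)) (trans (cong₂ combine (proj₁ both≡) (proj₂ both≡)) (Fin.combine-remQuot {h} Φ v)))
    where
    collision : (u : Fin (h * Φ)) → Collision (proj₁ (remQuot {h} Φ u)) (proj₂ (remQuot {h} Φ u))
    collision u = c _ _

  result : HasRainbowAP k f
  result with Fin.any? (λ a → Fin.any? (λ j → ¬? (collision? a j)))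
  ... | yes (a , j , ¬c) = rainbow a j ¬c
  ... | no ¬∃ = contradiction (count (λ a j → decidable-stable (collision? a j) (λ ¬c → ¬∃ (a , j , ¬c))))
      -- There are h Φ progressions and k n m codes; since n = 2 h, the hypothesis 2 k m < Φ rules
      -- out an injection.
      (<⇒≱ (begin-strict
        k * ((h + h) * m)      ≡⟨ e k h m ⟩
        h * (2 * (k * m))      <⟨ *-monoʳ-< h {{>-nonZero (*-mono-≤ 1≤k 1≤X)}} large ⟩
        h * Φ                  ∎))
    where
    open ≤-Reasoning
    e : ∀ k h m → k * ((h + h) * m) ≡ h * (2 * (k * m))
    e = solve-∀

-- Existence of the sub-Ramsey number, and the bound

module _ {n r} (f : Fin n → Fin r) where

  private
    -- The search looks at c only, so points of equal colour receive the same representative,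
    -- whatever the proof e.
    pick : ∀ c → (∃ λ y → f y ≡ c) → Fin n
    pick c e with Fin.any? (λ y → f y Fin.≟ c)
    ... | yes (y , _) = y
    ... | no ¬e       = ⊥-elim (¬e e)

    f-pick : ∀ c e → f (pick c e) ≡ c
    f-pick c e with Fin.any? (λ y → f y Fin.≟ c)
    ... | yes (_ , fy≡c) = fy≡c
    ... | no ¬e          = ⊥-elim (¬e e)

    pick-cong : ∀ {c c′} e e′ → c ≡ c′ → pick c e ≡ pick c′ e′
    pick-cong {c} e e′ refl with Fin.any? (λ y → f y Fin.≟ c)
    ... | yes _ = refl
    ... | no ¬e = ⊥-elim (¬e e)

  -- Using elements of Fin n as colours leaves finitely many colourings to check.
  recolour : Fin n → Fin n
  recolour x = pick (f x) (x , refl)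

  f-recolour : ∀ x → f (recolour x) ≡ f x
  f-recolour x = f-pick (f x) (x , refl)

  recolour-cong : ∀ {x y} → f x ≡ f y → recolour x ≡ recolour y
  recolour-cong = pick-cong _ _

  recolour-atMost : ∀ {m} → AtMost m f → AtMost m recolour
  recolour-atMost atMost c = ≤-trans (length-mono-≤ (filter⁺
    (λ x → recolour x Fin.≟ c) (λ x → f x Fin.≟ f c)
    (λ { refl eq → trans (sym (f-recolour _)) (cong f eq) }) (⊆-refl {x = allFin n}))) (atMost (f c))

  recolour-rainbow : ∀ {k} → HasRainbowAP k recolour → HasRainbowAP k f
  recolour-rainbow (P , ap , inj) = P , ap , λ eq → inj (recolour-cong eq)

-- With at least two terms, the first two determine a and d, leaving a single candidate to test.
isArithmeticProgression? : ∀ {k n} (P : Fin (2 + k) → Fin n) → Dec (IsArithmeticProgression P)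
isArithmeticProgression? P = map′
  (λ (1≤d , h) → a , d , 1≤d , h)
  (λ { (a′ , d′ , 1≤d′ , h) → subst₂ (λ a d → 1 ≤ d × (∀ i → suc (toℕ (P i)) ≡ a + toℕ i * d))
    (sym (trans (h Fin.zero) (+-identityʳ a′)))
    (sym (trans (cong₂ _∸_ (h (Fin.suc Fin.zero)) (h Fin.zero)) (difference a′ d′)))
    (1≤d′ , h) })
  (1 ≤? d ×-dec Fin.all? (λ i → suc (toℕ (P i)) ≟ a + toℕ i * d))
  where
  a d : ℕ
  a = suc (toℕ (P Fin.zero))
  d = toℕ (P (Fin.suc Fin.zero)) ∸ toℕ (P Fin.zero)
  difference : ∀ a d → (a + (d + 0)) ∸ (a + 0) ≡ d
  difference a d = trans (cong₂ (λ u v → (a + u) ∸ v) (+-identityʳ d) (+-identityʳ a)) (m+n∸m≡n a d)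

-- Maps into `Fin n` are coded by numbers below n^(2+k). Decoding returns a map only up to pointwise
-- equality, so the properties are carried over pointwise.
hasRainbowAP? : ∀ k {n r} (f : Fin n → Fin r) → Dec (HasRainbowAP (2 + k) f)
hasRainbowAP? k {n} f = map′
  (λ (c , ap , inj) → finToFun c , ap , λ {i} {j} → inj i j)
  (λ { (P , (a , d , 1≤d , h) , inj) → let P≗ = Fin.finToFun-funToFin P in
    funToFin P , (a , d , 1≤d , λ i → trans (cong (suc ∘ toℕ) (P≗ i)) (h i)) ,
    λ i j eq → inj (trans (sym (cong f (P≗ i))) (trans eq (cong f (P≗ j)))) })
  (Fin.any? {n ^ (2 + k)} (λ c → isArithmeticProgression? (finToFun c) ×-dec
    Fin.all? (λ i → Fin.all? (λ j → f (finToFun c i) Fin.≟ f (finToFun c j) →-dec i Fin.≟ j))))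

atMost? : ∀ m {n r} (f : Fin n → Fin r) → Dec (AtMost m f)
atMost? m f = Fin.all? (λ c → length (filter (λ x → f x Fin.≟ c) (allFin _)) ≤? m)

atMost-resp-≗ : ∀ m {n r} {f g : Fin n → Fin r} → (∀ x → f x ≡ g x) → AtMost m f → AtMost m g
atMost-resp-≗ m {n} {f = f} {g} f≗g atMost c = ≤-trans (length-mono-≤ (filter⁺
  (λ x → g x Fin.≟ c) (λ x → f x Fin.≟ c) (λ { refl eq → trans (f≗g _) eq }) (⊆-refl {x = allFin n}))) (atMost c)

-- The number r of colours is unbounded, but `recolour` reduces to r = n, where only n^n colourings
-- remain.
forcesRainbowAP? : ∀ m k n → Dec (ForcesRainbowAP m (2 + k) n)
forcesRainbowAP? m k n = map′ to
  (λ forces c → forces n (decode c))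
  (Fin.all? (λ c → atMost? m (decode c) →-dec hasRainbowAP? k (decode c)))
  where
  decode : Fin (n ^ n) → Fin n → Fin n
  decode = finToFun
  to : (∀ c → AtMost m (decode c) → HasRainbowAP (2 + k) (decode c)) → ForcesRainbowAP m (2 + k) n
  to h r f atMost = recolour-rainbow f (P , ap , λ {i} {j} eq → inj (trans (g≗ (P i)) (trans eq (sym (g≗ (P j))))))
    where
    g≗ : ∀ x → decode (funToFin (recolour f)) x ≡ recolour f x
    g≗ = Fin.finToFun-funToFin (recolour f)
    found = h (funToFin (recolour f)) (atMost-resp-≗ m (λ x → sym (g≗ x)) (recolour-atMost f atMost))
    P = proj₁ found
    ap = proj₁ (proj₂ found)
    inj = proj₂ (proj₂ found)

leastPositive : ∀ {Q : ℕ → Set} → (∀ n → Dec (Q n)) → ∀ n → 1 ≤ n → Q n →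
  ∃ λ s → 1 ≤ s × Q s × (∀ j → 1 ≤ j → Q j → s ≤ j) × s ≤ n
leastPositive {Q} Q? n 1≤n Qn = search (n ∸ 1) 1 ≤-refl (m+[n∸m]≡n 1≤n) (λ j 1≤j _ → 1≤j)
  where
  search : ∀ fuel s → 1 ≤ s → s + fuel ≡ n → (∀ j → 1 ≤ j → Q j → s ≤ j) →
    ∃ λ s → 1 ≤ s × Q s × (∀ j → 1 ≤ j → Q j → s ≤ j) × s ≤ n
  search zero s 1≤s s+0≡n below = s , 1≤s , subst Q n≡s Qn , below , ≤-reflexive (sym n≡s)
    where n≡s = sym (trans (sym (+-identityʳ s)) s+0≡n)
  search (suc fuel) s 1≤s s+≡n below with Q? s
  ... | yes Qs = s , 1≤s , Qs , below , m+n≤o⇒m≤o s (≤-reflexive s+≡n)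
  ... | no ¬Qs = search fuel (suc s) (s≤s z≤n) (trans (sym (+-suc s fuel)) s+≡n)
    (λ j 1≤j Qj → ≤∧≢⇒< (below j 1≤j Qj) (λ { refl → ¬Qs Qj }))

subRamseyNumber-≤ : ∀ m k n → 2 ≤ k → 1 ≤ n → ForcesRainbowAP m k n → ∃ λ s → IsSubRamseyNumber m k s × s ≤ n
subRamseyNumber-≤ m (suc (suc k)) n (s≤s (s≤s z≤n)) 1≤n forces with leastPositive (forcesRainbowAP? m k) n 1≤n forces
... | s , 1≤s , Qs , least , s≤n = s , record { positive = 1≤s ; forces = Qs ; minimal = least } , s≤n

-- Take n = 2 k X with X the least power of two above q = t ℓ k m. The bound t ≥ 2^21 puts x beyond
-- `threshold` and makes the rough numbers below X more than 2 k m. The 2 in `n * 2` pays for the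
-- later use of log k ≥ `lg k` / 2.
∃-forcing : ∀ t → 2 * 2 ^ 20 ≤ t → ∀ m k → 1 ≤ m → 2 ≤ k →
  ∃ λ n → 1 ≤ n × ForcesRainbowAP m k n × n * 2 ≤ 16 * t * (m * k ^ 2) * lg k
∃-forcing t t≥ m k 1≤m 2≤k = k * X + k * X , ≤-trans 1≤kX (m≤m+n _ _) ,
  forces-rainbow m k K X (<⇒≤ 2≤k) (1≤2^ x) (<⇒≤ (n<2^[1+lg] k)) many , bound
  where
  open ≤-Reasoning
  a = lg k
  ℓ = suc a
  K = 2 ^ ℓ
  q = t * (ℓ * (k * m))
  x = suc (lg q)
  X = 2 ^ x
  Φ = ∑ X (ρ K)
  1≤k : 1 ≤ k
  1≤k = <⇒≤ 2≤k
  1≤a : 1 ≤ a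
  1≤a = 2^≤⇒≤lg 2≤k
  1≤t : 1 ≤ t
  1≤t = ≤-trans (1≤2^ 21) t≥
  1≤kX : 1 ≤ k * X
  1≤kX = *-mono-≤ 1≤k (1≤2^ x)
  1≤q : 1 ≤ q
  1≤q = *-mono-≤ 1≤t (*-mono-≤ (s≤s (z≤n {a})) (*-mono-≤ 1≤k 1≤m))
  q<X : q < X
  q<X = n<2^[1+lg] q
  X≤2q : X ≤ 2 * q
  X≤2q = *-monoʳ-≤ 2 (2^lg≤ 1≤q)
  e₁ : ∀ k ℓ u → 2 * k * (ℓ * u) ≡ 2 * u * (ℓ * k)
  e₁ = solve-∀
  threshold<x : threshold a < x
  threshold<x = 2^-cancel-< (threshold a) x (begin-strict
    2 ^ (ℓ + (lg ℓ + 20))              ≡⟨ ^-distribˡ-+-* 2 ℓ (lg ℓ + 20) ⟩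
    K * 2 ^ (lg ℓ + 20)                ≡⟨ cong (K *_) (^-distribˡ-+-* 2 (lg ℓ) 20) ⟩
    K * (2 ^ lg ℓ * 2 ^ 20)            ≤⟨ *-mono-≤ (*-monoʳ-≤ 2 (2^lg≤ 1≤k)) (*-monoˡ-≤ (2 ^ 20) (2^lg≤ {ℓ} (s≤s z≤n))) ⟩
    2 * k * (ℓ * 2 ^ 20)               ≡⟨ e₁ k ℓ (2 ^ 20) ⟩
    2 * 2 ^ 20 * (ℓ * k)               ≤⟨ *-mono-≤ t≥ (*-monoʳ-≤ ℓ (m≤m*n k m {{>-nonZero 1≤m}})) ⟩
    q                                  <⟨ q<X ⟩
    X                                  ∎)
  e₂ : ∀ ℓ c → 1024 * ℓ * (2 * c) ≡ 2048 * (ℓ * c)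
  e₂ = solve-∀
  many : 2 * (k * m) < Φ
  many = ≰⇒> (λ few → <⇒≱ q<X (begin
    X                                  ≤⟨ rough-count a x threshold<x ⟩
    1024 * ℓ * Φ                       ≤⟨ *-monoʳ-≤ (1024 * ℓ) few ⟩
    1024 * ℓ * (2 * (k * m))           ≡⟨ e₂ ℓ (k * m) ⟩
    2048 * (ℓ * (k * m))               ≤⟨ *-monoˡ-≤ (ℓ * (k * m)) (≤-trans (2^-mono {11} {21} (from-yes (11 ≤? 21))) t≥) ⟩
    q                                  ∎))
  e₃ : ∀ k t ℓ m → (k * (2 * (t * (ℓ * (k * m)))) + k * (2 * (t * (ℓ * (k * m))))) * 2 ≡ 8 * (t * (m * (k * k))) * ℓ
  e₃ = solve-∀
  e₄ : ∀ k t a m → 8 * (t * (m * (k * k))) * (a + a) ≡ 16 * t * (m * (k * (k * 1))) * a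
  e₄ = solve-∀
  bound : (k * X + k * X) * 2 ≤ 16 * t * (m * k ^ 2) * a
  bound = begin
    (k * X + k * X) * 2                        ≤⟨ *-monoˡ-≤ 2 (+-mono-≤ (*-monoʳ-≤ k X≤2q) (*-monoʳ-≤ k X≤2q)) ⟩
    (k * (2 * q) + k * (2 * q)) * 2            ≡⟨ e₃ k t ℓ m ⟩
    -- k ≥ 2 gives ℓ = a + 1 ≤ 2 a.
    8 * (t * (m * (k * k))) * ℓ                ≤⟨ *-monoʳ-≤ (8 * (t * (m * (k * k)))) (+-monoˡ-≤ a 1≤a) ⟩
    8 * (t * (m * (k * k))) * (a + a)          ≡⟨ e₄ k t a m ⟩
    16 * t * (m * k ^ 2) * a                   ∎

-- Comparison of binary and natural logarithms

ℕ/1-* : ∀ a b → ℤ.+ (a * b) / 1 ≡ (ℤ.+ a / 1) ℚ.* (ℤ.+ b / 1)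
ℕ/1-* a b = ℚ.toℚᵘ-injective (ℚᵘ.≃-trans (ℚ.toℚᵘ-fromℚᵘ (ℚᵘ.mkℚᵘ (ℤ.+ (a * b)) 0))
  (ℚᵘ.≃-trans (ℚᵘ.*≡* (cong (ℤ._* ℤ.+ 1) (ℤ.pos-* a b)))
  (ℚᵘ.≃-sym (ℚᵘ.≃-trans (ℚ.toℚᵘ-homo-* (ℤ.+ a / 1) (ℤ.+ b / 1))
    (ℚᵘ.*-cong (ℚ.toℚᵘ-fromℚᵘ (ℚᵘ.mkℚᵘ (ℤ.+ a) 0)) (ℚ.toℚᵘ-fromℚᵘ (ℚᵘ.mkℚᵘ (ℤ.+ b) 0)))))))

ℕ/1-mono : ∀ {a b} → a ≤ b → ℤ.+ a / 1 ℚ.≤ ℤ.+ b / 1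
ℕ/1-mono {a} {b} a≤b = ℚ.toℚᵘ-cancel-≤
  (ℚᵘ.≤-respʳ-≃ (ℚᵘ.≃-sym (ℚ.toℚᵘ-fromℚᵘ (ℚᵘ.mkℚᵘ (ℤ.+ b) 0)))
  (ℚᵘ.≤-respˡ-≃ (ℚᵘ.≃-sym (ℚ.toℚᵘ-fromℚᵘ (ℚᵘ.mkℚᵘ (ℤ.+ a) 0)))
  (ℚᵘ.*≤* (ℤ.*-monoʳ-≤-nonNeg (ℤ.+ 1) (ℤ.+≤+ a≤b)))))

∑<-frac-length : ∀ {m n} N → m ≤ n → ∑< m (λ j → frac (N + j)) ℚ.≤ ∑< n (λ j → frac (N + j))
∑<-frac-length {m} {n} N m≤n = begin
  ∑< m g                                                  ≡⟨ ℚ.+-identityʳ (∑< m g) ⟨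
  ∑< m g ℚ.+ 0ℚ                                           ≡⟨ cong (∑< m g ℚ.+_) (trans (∑<-const (n ∸ m) 0ℚ) (ℚ.*-zeroʳ (ℤ.+ (n ∸ m) / 1))) ⟨
  ∑< m g ℚ.+ ∑< (n ∸ m) (λ _ → 0ℚ)                        ≤⟨ ℚ.+-monoʳ-≤ (∑< m g) (∑<-mono (n ∸ m) (λ j _ → frac-nonNeg (N + (m + j)))) ⟩
  ∑< m g ℚ.+ ∑< (n ∸ m) (λ j → g (m + j))                 ≡⟨ ∑<-+ m (n ∸ m) g ⟨
  ∑< (m + (n ∸ m)) g                                      ≡⟨ cong (λ z → ∑< z g) (m+[n∸m]≡n m≤n) ⟩
  ∑< n g                                                  ∎
  where
  open ℚ.≤-Reasoning
  g : ℕ → ℚ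
  g j = frac (N + j)

-- Each of the T terms is at least 1/(2T).
∑<-frac-dyadic : ∀ T → 1 ≤ T → ½ ℚ.≤ ∑< T (λ i → frac (T + i))
∑<-frac-dyadic (suc T) _ = begin
  ½                                                       ≡⟨ frac-split T 1 ⟨
  (ℤ.+ suc T / 1) ℚ.* frac (1 + T * 2)                      ≡⟨ ∑<-const (suc T) _ ⟨
  ∑< (suc T) (λ _ → frac (1 + T * 2))                     ≤⟨ ∑<-mono (suc T) (λ i i<T → frac-anti (≤-trans (+-monoʳ-≤ (suc T) (s≤s⁻¹ i<T)) (≤-reflexive (e T)))) ⟩
  ∑< (suc T) (λ i → frac (suc T + i))                     ∎
  where
  open ℚ.≤-Reasoning
  e : ∀ T → suc T + T ≡ 1 + T * 2
  e = solve-∀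

-- Doubling the upper limit appends the terms with denominators from T + 1 to 2 T, where T = 2^a N;
-- by `∑<-frac-dyadic` they add at least ½.
riemannSum-2^ : ∀ N → 1 ≤ N → ∀ a → (ℤ.+ a / 1) ℚ.* ½ ℚ.≤ riemannSum (2 ^ a) N
riemannSum-2^ N 1≤N zero    = ℚ.≤-reflexive (ℚ.*-zeroˡ ½)
riemannSum-2^ N 1≤N (suc a) = begin
  (ℤ.+ suc a / 1) ℚ.* ½                                     ≡⟨ ∑<-const (suc a) ½ ⟨
  ∑< a (λ _ → ½) ℚ.+ ½                                    ≡⟨ cong (ℚ._+ ½) (∑<-const a ½) ⟩
  (ℤ.+ a / 1) ℚ.* ½ ℚ.+ ½                                   ≤⟨ ℚ.+-mono-≤ (riemannSum-2^ N 1≤N a) (∑<-frac-dyadic T (*-mono-≤ (1≤2^ a) 1≤N)) ⟩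
  ∑< L g ℚ.+ ∑< T (λ i → frac (T + i))                    ≤⟨ ℚ.+-monoʳ-≤ (∑< L g) (∑<-mono T (λ i _ → ℚ.≤-reflexive (cong frac (shift i)))) ⟩
  ∑< L g ℚ.+ ∑< T (λ i → g (L + i))                       ≡⟨ ∑<-+ L T g ⟨
  ∑< (L + T) g                                            ≡⟨ cong (λ z → ∑< z g) length≡ ⟩
  riemannSum (2 ^ suc a) N                                ∎
  where
  open ℚ.≤-Reasoning
  T = 2 ^ a * N
  L = (2 ^ a ∸ 1) * N
  g : ℕ → ℚ
  g j = frac (N + j)
  N+L≡T : N + L ≡ T
  N+L≡T = cong (_* N) (m+[n∸m]≡n (1≤2^ a))
  shift : ∀ i → T + i ≡ N + (L + i)
  shift i = trans (cong (_+ i) (sym N+L≡T)) (+-assoc N L i)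
  length≡ : L + T ≡ (2 ^ suc a ∸ 1) * N
  length≡ = trans (sym (*-distribʳ-+ N (2 ^ a ∸ 1) (2 ^ a))) (cong (_* N) (trans (+-comm (2 ^ a ∸ 1) (2 ^ a))
    (trans (sym (+-∸-assoc (2 ^ a) (1≤2^ a))) (cong (λ z → 2 ^ a + z ∸ 1) (sym (+-identityʳ (2 ^ a)))))))

riemannSum-≥-lg : ∀ k N → 1 ≤ k → 1 ≤ N → (ℤ.+ lg k / 1) ℚ.* ½ ℚ.≤ riemannSum k N
riemannSum-≥-lg k N 1≤k 1≤N = ℚ.≤-trans (riemannSum-2^ N 1≤N (lg k))
  (∑<-frac-length N (*-monoˡ-≤ N (∸-monoˡ-≤ 1 (2^lg≤ 1≤k))))

≤-log : ∀ s c M k → 1 ≤ k → s * 2 ≤ c * M * lg k → fromℕ s ≤ʳ fromℕ c *ʳ fromℕ M *ʳ log k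
-- The estimate holds at every mesh 1/N with N ≥ 1; at N = 0 the sum is empty, hence the starting
-- index 1.
≤-log s c M k 1≤k h ε 0<ε = 1 , λ N 1≤N → begin
  ℤ.+ s / 1                                               ≡⟨ ℚ.*-identityʳ (ℤ.+ s / 1) ⟨
  (ℤ.+ s / 1) ℚ.* ((ℤ.+ 2 / 1) ℚ.* ½)                         ≡⟨ ℚ.*-assoc (ℤ.+ s / 1) (ℤ.+ 2 / 1) ½ ⟨
  (ℤ.+ s / 1) ℚ.* (ℤ.+ 2 / 1) ℚ.* ½                           ≡⟨ cong (ℚ._* ½) (ℕ/1-* s 2) ⟨
  (ℤ.+ (s * 2) / 1) ℚ.* ½                                   ≤⟨ ℚ.*-monoʳ-≤-nonNeg ½ (ℕ/1-mono h) ⟩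
  (ℤ.+ (c * M * lg k) / 1) ℚ.* ½                            ≡⟨ cong (ℚ._* ½) (trans (ℕ/1-* (c * M) (lg k)) (cong (ℚ._* (ℤ.+ lg k / 1)) (ℕ/1-* c M))) ⟩
  (ℤ.+ c / 1) ℚ.* (ℤ.+ M / 1) ℚ.* (ℤ.+ lg k / 1) ℚ.* ½          ≡⟨ ℚ.*-assoc cM (ℤ.+ lg k / 1) ½ ⟩
  cM ℚ.* ((ℤ.+ lg k / 1) ℚ.* ½)                             ≤⟨ ℚ.*-monoˡ-≤-nonNeg cM {{subst ℚ.NonNegative (ℕ/1-* c M) (ℚ.normalize-nonNeg (c * M) 1)}} (riemannSum-≥-lg k N 1≤k 1≤N) ⟩
  cM ℚ.* riemannSum k N                                   ≡⟨ ℚ.+-identityʳ _ ⟨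
  cM ℚ.* riemannSum k N ℚ.+ 0ℚ                            ≤⟨ ℚ.+-monoʳ-≤ (cM ℚ.* riemannSum k N) (ℚ.<⇒≤ 0<ε) ⟩
  cM ℚ.* riemannSum k N ℚ.+ ε                             ∎
  where
  open ℚ.≤-Reasoning
  cM = (ℤ.+ c / 1) ℚ.* (ℤ.+ M / 1)

subRamseyBound : ∀ t → 2 * 2 ^ 20 ≤ t → ∃ λ (c : ℝ) → 0ʳ <ʳ c × ((m k : ℕ) → 1 ≤ m → 2 ≤ k →
  ∃ λ s → IsSubRamseyNumber m k s × fromℕ s ≤ʳ c *ʳ fromℕ (m * k ^ 2) *ʳ log k)
subRamseyBound t t≥ = fromℕ (16 * t) ,
  (1ℚ , ℚ.positive⁻¹ 1ℚ , 0 , λ _ _ → ℕ/1-mono {1} {16 * t} (*-mono-≤ {1} {16} (s≤s z≤n) (≤-trans (1≤2^ 21) t≥))) ,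
  λ m k 1≤m 2≤k → let
      n , 1≤n , forces , n≤ = ∃-forcing t t≥ m k 1≤m 2≤k
      s , isSR , s≤n = subRamseyNumber-≤ m k n 2≤k 1≤n forces
    in s , isSR , ≤-log s (16 * t) (m * k ^ 2) k (<⇒≤ 2≤k) (≤-trans (*-monoˡ-≤ 2 s≤n) n≤)

corollary3 : ∃ λ (c : ℝ) → 0ʳ <ʳ c × ((m k : ℕ) → 1 ≤ m → 2 ≤ k →
    ∃ λ s → IsSubRamseyNumber m k s × fromℕ s ≤ʳ c *ʳ fromℕ (m * k ^ 2) *ʳ log k)
corollary3 = subRamseyBound (2 * 2 ^ 20) ≤-refl
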